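{- For each integer $t\ge 1$ let $S_{\mathrm a}(t)$ be the number of $3\times 3$ semimagic squares with magic sum $t$. Then $\sum_{t>0} S_{\mathrm a}(t)\,x^t$ equals $$\frac{72x^{15}\,A(x)}{(1-x^3)^2(1-x^4)(1-x^5)(1-x^6)(1-x^7)(1-x^8)},$$ where $$A(x)=18x^{21}+5x^{20}+15x^{19}+11x^{17}-8x^{16}+x^{15}-23x^{14}-13x^{13}-22x^{12}-9x^{11}-16x^{10}+x^9-3x^8+7x^7+7x^6+9x^5+7x^4+6x^3+4x^2+2x+1.$$ Moreover, for every integer $t\ge1$, $$S_{\mathrm a}(t)=\tfrac18t^4-\tfrac92t^3+a_2(t)\,t^2-a_1(t)\,t+a_0(t)-72\,S_7(t),$$ where $S_7(t)=\left\lfloor\frac{t-1}{21}\right\rfloor+\epsilon(t)$ with $\epsilon(t)=1$ if $t\equiv 10,13,16,17,19,20\pmod{21}$ and $\epsilon(t)=0$ otherwise; $a_2(t)=\frac{243}{4}$ if $t\equiv0$; $\frac{218}{4}$ if $t\equiv1,5$; $\frac{227}{4}$ if $t\equiv2,4$; $\frac{234}{4}$ if $t\equiv3\pmod 6$; $a_1(t)=\frac{1968}{5}$ if $t\equiv0$; $\frac{1158}{5}$ if $t\equiv1,5$; $\frac{1383}{5}$ if $t\equiv2,10$; $\frac{1653}{5}$ if $t\equiv3$; $\frac{1428}{5}$ if $t\equiv4,8$; $\frac{1923}{5}$ if $t\equiv6$; $\frac{1113}{5}$ if $t\equiv7,11$; $\frac{1698}{5}$ if $t\equiv9\pmod{12}$;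 and $a_0(t)$ depends only on $t$ modulo $120$ and is given as follows, where in the line for $r$ the six numbers are the values of $a_0$ at $t\equiv r,\ r+20,\ r+40,\ r+60,\ r+80,\ r+100\pmod{120}$, in this order: $r=0$: $1224,\ 524,\ 584,\ 1188,\ 560,\ 548$; $r=1$: $\frac{7259}{40},\ \frac{31419}{40},\ \frac{6299}{40},\ \frac{8699}{40},\ \frac{29979}{40},\ \frac{7739}{40}$; $r=2$: $\frac{1801}{5},\ \frac{1741}{5},\ \frac{5121}{5},\ \frac{1621}{5},\ \frac{1921}{5},\ \frac{4941}{5}$; $r=3$: $\frac{23067}{40},\ \frac{827}{40},\ \frac{347}{40},\ \frac{24507}{40},\ \frac{ -613}{40},\ \frac{1787}{40}$; $r=4$: $\frac{2452}{5},\ \frac{5832}{5},\ \frac{2332}{5},\ \frac{2632}{5},\ \frac{5652}{5},\ \frac{2512}{5}$; $r=5$: $\frac{2239}{8},\ \frac{2143}{8},\ \frac{6975}{8},\ \frac{1951}{8},\ \frac{2431}{8},\ \frac{6687}{8}$; $r=6$: $\frac{4653}{5},\ \frac{1513}{5},\ \frac{1453}{5},\ \frac{4833}{5},\ \frac{1333}{5},\ \frac{1633}{5}$; $r=7$: $\frac{5243}{40},\ \frac{26523}{40},\ \frac{4283}{40},\ \frac{3803}{40},\ \frac{27963}{40},\ \frac{2843}{40}$; $r=8$: $\frac{2224}{5},\ \frac{2164}{5},\ \frac{5544}{5},\ \frac{2044}{5},\ \frac{2344}{5},\ \frac{5364}{5}$; $r=9$: $\frac{31131}{40},\ \frac{8891}{40},\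 \frac{8411}{40},\ \frac{32571}{40},\ \frac{7451}{40},\ \frac{9851}{40}$; $r=10$: $413,\ 1017,\ 389,\ 377,\ 1053,\ 353$; $r=11$: $\frac{539}{40},\ \frac{2939}{40},\ \frac{24219}{40},\ \frac{1979}{40},\ \frac{1499}{40},\ \frac{25659}{40}$; $r=12$: $\frac{5796}{5},\ \frac{2656}{5},\ \frac{2596}{5},\ \frac{5976}{5},\ \frac{2476}{5},\ \frac{2776}{5}$; $r=13$: $\frac{7547}{40},\ \frac{28827}{40},\ \frac{6587}{40},\ \frac{6107}{40},\ \frac{30267}{40},\ \frac{5147}{40}$; $r=14$: $\frac{1477}{5},\ \frac{1777}{5},\ \frac{4797}{5},\ \frac{1657}{5},\ \frac{1597}{5},\ \frac{4977}{5}$; $r=15$: $\frac{5823}{8},\ \frac{799}{8},\ \frac{1279}{8},\ \frac{5535}{8},\ \frac{1087}{8},\ \frac{991}{8}$; $r=16$: $\frac{2488}{5},\ \frac{5508}{5},\ \frac{2368}{5},\ \frac{2308}{5},\ \frac{5688}{5},\ \frac{2188}{5}$; $r=17$: $\frac{8603}{40},\ \frac{11003}{40},\ \frac{32283}{40},\ \frac{10043}{40},\ \frac{9563}{40},\ \frac{33723}{40}$; $r=18$: $\frac{4689}{5},\ \frac{1189}{5},\ \frac{1489}{5},\ \frac{4509}{5},\ \frac{1369}{5},\ \frac{1309}{5}$; $r=19$: $\frac{2651}{40},\ \frac{26811}{40},\ \frac{1691}{40},\ \frac{4091}{40},\ \frac{25371}{40},\ \frac{3131}{40}$. The quasipolynomial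 $S_{\mathrm a}$ has period exactly $840$, and its principal constituent is $\frac18t^4-\frac92t^3+\frac{243}{4}t^2-\frac{13896}{35}t+1296$.
   Context: A $3\times3$ semimagic square (in the strong sense) is a $3\times 3$ matrix of pairwise distinct positive integers in which all three row sums and all three column sums are equal; the common value is the magic sum. Squares are counted as matrices (not up to symmetry). A function $N$ of $t\in\mathbb Z_{>0}$ is a quasipolynomial if there are a positive integer $p$ and polynomials $N_0,\dots,N_{p-1}$ (the constituents) with $N(t)=N_{t \bmod p}(t)$; the minimal such $p$ is the period, and $N_0$ is the principal constituent. -}

module Defs where

open import Data.Bool using (if_then_else_)
open import Data.Fin using (Fin)
open import Data.Integer as ℤ using (ℤ; +_; -_)
import Data.Integer.Properties as ℤ
open import Data.List as List using (List; []; _∷_; upTo; cartesianProductWith; filter; length)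
open import Data.List.Membership.Propositional using (_∈_)
open import Data.List.Membership.Propositional.Properties using (∈-map⁺; ∈-upTo⁺; ∈-cartesianProductWith⁺; ∈-filter⁺; ∈-filter⁻)
import Data.List.Relation.Unary.All as ListAll
import Data.List.Relation.Unary.AllPairs as ListAllPairs
open import Data.List.Relation.Unary.Any using (here)
import Data.List.Relation.Unary.Unique.Propositional as List
import Data.List.Relation.Unary.Unique.Propositional.Properties as ListUnique
open import Data.Nat using (ℕ; zero; suc; _+_; _∸_; _≤_; _<_; s≤s; NonZero; _/_; _%_; _≟_; _<?_)
open import Data.Nat.DivMod using (_mod_)
open import Data.Nat.Properties using (≤-trans; ≤-reflexive; m≤m+n; m≤n+m; suc-injective)
open import Data.List.Membership.DecPropositional _≟_ using (_∈?_)
open import Data.Product using (Σ; ∃; _×_; _,_; proj₁; proj₂)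
open import Data.Rational as ℚ using (ℚ; 0ℚ)
open import Data.Vec as Vec using (Vec; []; _∷_; lookup; concat; transpose; sum)
open import Data.Vec.Properties using (∷-injective)
open import Data.Vec.Relation.Unary.All as All using (All; []; _∷_; all?)
open import Data.Vec.Relation.Unary.All.Properties using (concat⁻)
open import Data.Vec.Relation.Unary.AllPairs using (allPairs?)
open import Data.Vec.Relation.Unary.Unique.Propositional using (Unique)
open import Function using (_∘_; _⇔_; mk⇔)
open import Relation.Binary.PropositionalEquality using (_≡_; refl; sym; trans; cong; cong₂; _≗_)
open import Relation.Nullary.Decidable using (Dec; does; map′; _×-dec_; ¬?)

Matrix : Set
Matrix = Vec (Vec ℕ 3) 3

record IsSemimagic (t : ℕ) (M : Matrix) : Set where
  constructor semimagic
  field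
    positive : All (0 <_) (concat M)
    distinct : Unique (concat M)
    rows     : All (λ r → sum r ≡ t) M
    columns  : All (λ c → sum c ≡ t) (transpose M)

isSemimagic? : ∀ t M → Dec (IsSemimagic t M)
isSemimagic? t M =
  map′ (λ (p , d , r , c) → semimagic p d r c)
       (λ (semimagic p d r c) → p , d , r , c)
       (all? (0 <?_) (concat M)
        ×-dec allPairs? (λ m n → ¬? (m ≟ n)) (concat M)
        ×-dec all? (λ r → sum r ≟ t) M
        ×-dec all? (λ c → sum c ≟ t) (transpose M))

vectors : ∀ {A : Set} → List A → ∀ n → List (Vec A n)
vectors xs zero    = [] ∷ []
vectors xs (suc n) = cartesianProductWith _∷_ xs (vectors xs n)

-- Entries are positive with row sums t, so searching the matrices with
-- entries in 1, …, t loses nothing; see ∈-semimagicSquares.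
semimagicSquares : ℕ → List Matrix
semimagicSquares t =
  filter (isSemimagic? t) (vectors (vectors (List.map suc (upTo t)) 3) 3)

Sₐ : ℕ → ℕ
Sₐ t = length (semimagicSquares t)

∈-vectors : ∀ {A : Set} {xs : List A} {n} {v : Vec A n} → All (_∈ xs) v → v ∈ vectors xs n
∈-vectors []       = here refl
∈-vectors (p ∷ ps) = ∈-cartesianProductWith⁺ _∷_ p (∈-vectors ps)

vectors-unique : ∀ {A : Set} {xs : List A} → List.Unique xs → ∀ n → List.Unique (vectors xs n)
vectors-unique u zero    = ListAll.[] ListAllPairs.∷ ListAllPairs.[]
vectors-unique u (suc n) =
  ListUnique.cartesianProductWith⁺ _∷_ ∷-injective u (vectors-unique u n)

entries≤sum : ∀ {n} (v : Vec ℕ n) → All (_≤ sum v) v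
entries≤sum []      = []
entries≤sum (m ∷ v) = m≤m+n m (sum v) ∷ All.map (λ p → ≤-trans p (m≤n+m (sum v) m)) (entries≤sum v)

∈-range : ∀ {m t} → 0 < m → m ≤ t → m ∈ List.map suc (upTo t)
∈-range {suc m} _ m<t = ∈-map⁺ suc (∈-upTo⁺ m<t)

∈-semimagicSquares : ∀ t M → M ∈ semimagicSquares t ⇔ IsSemimagic t M
∈-semimagicSquares t M =
  mk⇔ (λ p → proj₂ (∈-filter⁻ (isSemimagic? t) {xs = vectors (vectors (List.map suc (upTo t)) 3) 3} p))
      (λ s → ∈-filter⁺ (isSemimagic? t) (complete s) s)
  where
  row : ∀ {r} → All (0 <_) r × sum r ≡ t → r ∈ vectors (List.map suc (upTo t)) 3
  row {r} (pos , eq) = ∈-vectors (All.map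
    (λ (0<m , m≤) → ∈-range 0<m (≤-trans m≤ (≤-reflexive eq)))
    (All.zip (pos , entries≤sum r)))

  complete : IsSemimagic t M → M ∈ vectors (vectors (List.map suc (upTo t)) 3) 3
  complete s = ∈-vectors (All.map row
    (All.zip (concat⁻ M (IsSemimagic.positive s) , IsSemimagic.rows s)))

semimagicSquares-unique : ∀ t → List.Unique (semimagicSquares t)
semimagicSquares-unique t = ListUnique.filter⁺ (isSemimagic? t)
  (vectors-unique (vectors-unique (ListUnique.map⁺ suc-injective (ListUnique.upTo⁺ t)) 3) 3)

-- Formal power series over ℤ, compared with _≗_.
Series : Set
Series = ℕ → ℤ

infixr 8 x^_
infixr 7 _∙_
infixl 7 _⊛_
infixl 6 _⊘_
infix  8 1-x^_

x^_ : ℕ → Series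
(x^ k) n = if does (n ≟ k) then + 1 else + 0

1-x^_ : ℕ → Series
(1-x^ k) n = (x^ 0) n ℤ.- (x^ k) n

_∙_ : ℤ → Series → Series
(c ∙ F) n = c ℤ.* F n

-- The Cauchy product Σ_{i ≤ n} F i * G (n ∸ i), unfolded at i = 0.
_⊛_ : Series → Series → Series
(F ⊛ G) zero    = F 0 ℤ.* G 0
(F ⊛ G) (suc n) = F 0 ℤ.* G (suc n) ℤ.+ ((F ∘ suc) ⊛ G) n

-- P ⊘ D is the quotient P / D for D with constant term 1, by long division:
-- if P = p + x P′ and D = 1 + x D′ then P / D = p + x ((P′ - p D′) / D).
-- For other D the value is meaningless.
_⊘_ : Series → Series → Series
(P ⊘ D) zero    = P 0
(P ⊘ D) (suc n) = ((λ k → P (suc k) ℤ.- P 0 ℤ.* D (suc k)) ⊘ D) n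

⊘-⊛ : ∀ P D → D 0 ≡ + 1 → (P ⊘ D) ⊛ D ≗ P
⊘-⊛ P D D₀ zero    = trans (cong (P 0 ℤ.*_) D₀) (ℤ.*-identityʳ (P 0))
⊘-⊛ P D D₀ (suc n) = trans
  (cong (λ y → a ℤ.+ y) (⊘-⊛ (λ k → P (suc k) ℤ.- P 0 ℤ.* D (suc k)) D D₀ n))
  (trans (ℤ.+-comm a (P (suc n) ℤ.- a))
  (trans (ℤ.+-assoc (P (suc n)) (ℤ.- a) a)
  (trans (cong (λ y → P (suc n) ℤ.+ y) (ℤ.+-inverseˡ a)) (ℤ.+-identityʳ (P (suc n))))))
  where
  a : ℤ
  a = P 0 ℤ.* D (suc n)

fromCoefficients : List ℤ → Series
fromCoefficients []       n       = + 0
fromCoefficients (a ∷ as) zero    = a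
fromCoefficients (a ∷ as) (suc n) = fromCoefficients as n

A : Series
A = fromCoefficients coefficients
  where
  -- in ascending degree
  coefficients : List ℤ
  coefficients =
    + 1 ∷ + 2 ∷ + 4 ∷ + 6 ∷ + 7 ∷ + 9 ∷ + 7 ∷ + 7 ∷
    - + 3 ∷ + 1 ∷ - + 16 ∷ - + 9 ∷ - + 22 ∷ - + 13 ∷ - + 23 ∷ + 1 ∷
    - + 8 ∷ + 11 ∷ + 0 ∷ + 15 ∷ + 5 ∷ + 18 ∷ []

denominator : Series
denominator = (1-x^ 3) ⊛ (1-x^ 3) ⊛ (1-x^ 4) ⊛ (1-x^ 5) ⊛ (1-x^ 6) ⊛ (1-x^ 7) ⊛ (1-x^ 8)

denominator₀ : denominator 0 ≡ + 1
denominator₀ = refl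

-- Σ_{t>0} Sₐ(t) xᵗ
generatingSeries : Series
generatingSeries zero      = + 0
generatingSeries t@(suc _) = + Sₐ t

fromℕ : ℕ → ℚ
fromℕ n = + n ℚ./ 1

-- Coefficients in ascending degree.
Polynomial : Set
Polynomial = List ℚ

evaluate : Polynomial → ℚ → ℚ
evaluate []       x = 0ℚ
evaluate (a ∷ as) x = a ℚ.+ x ℚ.* evaluate as x

HasConstituents : (ℕ → ℚ) → (p : ℕ) .{{_ : NonZero p}} → (Fin p → Polynomial) → Set
HasConstituents N p c = ∀ t → 1 ≤ t → N t ≡ evaluate (c (t mod p)) (fromℕ t)

IsQuasiperiod : (ℕ → ℚ) → (p : ℕ) .{{_ : NonZero p}} → Set
IsQuasiperiod N p = ∃ λ c → HasConstituents N p c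

HasPeriod : (ℕ → ℚ) → (p : ℕ) .{{_ : NonZero p}} → Set
HasPeriod N p = IsQuasiperiod N p × (∀ q .{{_ : NonZero q}} → IsQuasiperiod N q → p ≤ q)

-- P is the constituent at residue 0 when N is split modulo p; it is the principal
-- constituent when p is the period of N.  A constituent is determined as a
-- polynomial by its values at infinitely many t, so the existential over c
-- makes no choice beyond trailing zero coefficients.
HasConstituentAtZero : (ℕ → ℚ) → (p : ℕ) .{{_ : NonZero p}} → Polynomial → Set
HasConstituentAtZero N p P = ∃ λ c → HasConstituents N p c × c (0 mod p) ≡ P

IsPrincipalConstituent : (ℕ → ℚ) → Polynomial → Set
IsPrincipalConstituent N P =
  Σ ℕ λ p → Σ (NonZero p) λ p≢0 →
    HasPeriod N p {{p≢0}} × HasConstituentAtZero N p {{p≢0}} P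

infix 4 _over_

_over_ : ∀ {n} → Vec ℤ n → (d : ℕ) .{{_ : NonZero d}} → Vec ℚ n
ns over d = Vec.map (ℚ._/ d) ns

ε : ℕ → ℕ
ε t = if does (t % 21 ∈? (10 ∷ 13 ∷ 16 ∷ 17 ∷ 19 ∷ 20 ∷ [])) then 1 else 0

-- For t ≥ 1; truncated subtraction is then exact.
S₇ : ℕ → ℕ
S₇ t = (t ∸ 1) / 21 + ε t

a₂ : ℕ → ℚ
a₂ t = lookup ((+ 243 ∷ + 218 ∷ + 227 ∷ + 234 ∷ + 227 ∷ + 218 ∷ []) over 4) (t mod 6)

a₁ : ℕ → ℚ
a₁ t = lookup
  ((+ 1968 ∷ + 1158 ∷ + 1383 ∷ + 1653 ∷ + 1428 ∷ + 1158 ∷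
    + 1923 ∷ + 1113 ∷ + 1428 ∷ + 1698 ∷ + 1383 ∷ + 1113 ∷ []) over 5)
  (t mod 12)

-- Row r, column j holds the value at t ≡ r + 20 j (mod 120).
a₀-table : Vec (Vec ℚ 6) 20
a₀-table =
  ( ((+ 1224 ∷ + 524 ∷ + 584 ∷ + 1188 ∷ + 560 ∷ + 548 ∷ []) over 1)
  ∷ ((+ 7259 ∷ + 31419 ∷ + 6299 ∷ + 8699 ∷ + 29979 ∷ + 7739 ∷ []) over 40)
  ∷ ((+ 1801 ∷ + 1741 ∷ + 5121 ∷ + 1621 ∷ + 1921 ∷ + 4941 ∷ []) over 5)
  ∷ ((+ 23067 ∷ + 827 ∷ + 347 ∷ + 24507 ∷ - + 613 ∷ + 1787 ∷ []) over 40)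
  ∷ ((+ 2452 ∷ + 5832 ∷ + 2332 ∷ + 2632 ∷ + 5652 ∷ + 2512 ∷ []) over 5)
  ∷ ((+ 2239 ∷ + 2143 ∷ + 6975 ∷ + 1951 ∷ + 2431 ∷ + 6687 ∷ []) over 8)
  ∷ ((+ 4653 ∷ + 1513 ∷ + 1453 ∷ + 4833 ∷ + 1333 ∷ + 1633 ∷ []) over 5)
  ∷ ((+ 5243 ∷ + 26523 ∷ + 4283 ∷ + 3803 ∷ + 27963 ∷ + 2843 ∷ []) over 40)
  ∷ ((+ 2224 ∷ + 2164 ∷ + 5544 ∷ + 2044 ∷ + 2344 ∷ + 5364 ∷ []) over 5)
  ∷ ((+ 31131 ∷ + 8891 ∷ + 8411 ∷ + 32571 ∷ + 7451 ∷ + 9851 ∷ []) over 40)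
  ∷ ((+ 413 ∷ + 1017 ∷ + 389 ∷ + 377 ∷ + 1053 ∷ + 353 ∷ []) over 1)
  ∷ ((+ 539 ∷ + 2939 ∷ + 24219 ∷ + 1979 ∷ + 1499 ∷ + 25659 ∷ []) over 40)
  ∷ ((+ 5796 ∷ + 2656 ∷ + 2596 ∷ + 5976 ∷ + 2476 ∷ + 2776 ∷ []) over 5)
  ∷ ((+ 7547 ∷ + 28827 ∷ + 6587 ∷ + 6107 ∷ + 30267 ∷ + 5147 ∷ []) over 40)
  ∷ ((+ 1477 ∷ + 1777 ∷ + 4797 ∷ + 1657 ∷ + 1597 ∷ + 4977 ∷ []) over 5)
  ∷ ((+ 5823 ∷ + 799 ∷ + 1279 ∷ + 5535 ∷ + 1087 ∷ + 991 ∷ []) over 8)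
  ∷ ((+ 2488 ∷ + 5508 ∷ + 2368 ∷ + 2308 ∷ + 5688 ∷ + 2188 ∷ []) over 5)
  ∷ ((+ 8603 ∷ + 11003 ∷ + 32283 ∷ + 10043 ∷ + 9563 ∷ + 33723 ∷ []) over 40)
  ∷ ((+ 4689 ∷ + 1189 ∷ + 1489 ∷ + 4509 ∷ + 1369 ∷ + 1309 ∷ []) over 5)
  ∷ ((+ 2651 ∷ + 26811 ∷ + 1691 ∷ + 4091 ∷ + 25371 ∷ + 3131 ∷ []) over 40)
  ∷ [])

a₀ : ℕ → ℚ
a₀ t = lookup (lookup a₀-table (t mod 20)) ((t / 20) mod 6)

{-# OPTIONS --safe #-}

-- Up to the 72 row and column permutations and the reflection in the diagonal, a semimagic square has
-- its least entry m in the corner, increasing first row and first column, and first row below first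
-- column; such squares are parametrised by five positive integers, with magic sum
-- 2i + 2f + 2k + l + 3m and entries that are linear forms.  The condition that the entries are
-- distinct cuts the positive orthant along hyperplanes.  Splitting x < y, y < x, x = y repeatedly and
-- substituting y = x + y′ (and so on) breaks the complement into twenty simplicial unimodular cones, each
-- contributing x^(Σ w) / ∏ (1 - x^w) to the generating function for its vector w of weights.  All these
-- denominators divide the stated one, and the numerators add up to x^15 A.
--
-- The stated quasipolynomial satisfies the same linear recurrence: multiplying by the denominator kills
-- it from degree 37 on, because for each residue class the result is a polynomial with zero
-- coefficients.  The period is exactly 840 since a shorter quasiperiod q would make the constituents of 0
-- and q modulo 840 agree at infinitely many points, while their constant terms differ.

module Submission where

open import Defs

-- Every substitution only adds coefficients, so all linear forms keep natural coefficients. Two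
-- entries are thus certainly distinct on an open cone as soon as their forms differ and one
-- dominates the other coefficientwise, which is decidable. This is also why some cuts are made
-- where no entries coincide. The cones are relatively open and pairwise disjoint: every generator
-- is used at least once, hence the factor x^(Σ w), and no inclusion-exclusion occurs. The numerator
-- x^15 A and the denominator both have degree 36, so the rational function is not proper. The
-- principal constituent takes the value 1296 at 0, while the series starts with 0. A window of 37
-- consecutive coefficients must therefore avoid index 0 before the recurrence holds, and lower
-- degrees are compared one by one. Writing `S₇ t` as (t + `σ t`) / 21 with `σ` of period 21 leaves
-- a polynomial part of period 120, so 120 + 21 residue classes are checked in place of 840. The
-- factor 280 clears all denominators and keeps these checks in ℤ.

-- Cardinalities as enumerations, and counting by orbits.

module Counting where

  open import Data.Fin using (Fin)
  open import Data.List as List using (List; []; _∷_; _++_; length; allFin; cartesianProduct)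
  open import Data.List.Membership.Propositional using (_∈_)
  open import Data.List.Membership.Propositional.Properties
    using (∈-map⁺; ∈-map⁻; ∈-++⁺ˡ; ∈-++⁺ʳ; ∈-++⁻; ∈-cartesianProduct⁺; ∈-cartesianProduct⁻; ∈-allFin)
  open import Data.List.Membership.Propositional.Properties.WithK using (unique∧set⇒bag)
  open import Data.List.Properties using (length-++; length-map; length-tabulate)
  open import Data.List.Relation.Binary.BagAndSetEquality using (∼bag⇒↭)
  open import Data.List.Relation.Binary.Permutation.Propositional.Properties using (↭-length)
  import Data.List.Relation.Unary.All as ListAll
  import Data.List.Relation.Unary.All.Properties as ListAll
  import Data.List.Relation.Unary.AllPairs as ListAllPairs
  import Data.List.Relation.Unary.Unique.Propositional as List
  import Data.List.Relation.Unary.Unique.Propositional.Properties as ListUnique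
  open import Data.Nat using (ℕ; _+_; _*_)
  open import Data.Product using (∃; _×_; _,_; proj₁; proj₂)
  open import Data.Sum using (_⊎_; inj₁; inj₂; [_,_])
  open import Data.Unit using (⊤; tt)
  open import Function using (_∘_; _⇔_; mk⇔; Equivalence; case_of_)
  open import Relation.Binary.PropositionalEquality using (_≡_; refl; sym; trans; cong; cong₂; subst)
  open import Relation.Nullary using (¬_)
  open Equivalence using (to; from)

  record Count {A : Set} (P : A → Set) (n : ℕ) : Set where
    constructor counted
    field
      members : List A
      unique  : List.Unique members
      spec    : ∀ x → x ∈ members ⇔ P x
      size    : length members ≡ n

  -- Duplicate-free lists with the same members are permutations of each other. Two ways of
  -- enumerating one predicate therefore give an equation between numbers; recurrences and the
  -- factor 72 are obtained like this.
  count-deterministic : ∀ {A : Set} {P : A → Set} {m n} → Count P m → Count P n → m ≡ n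
  count-deterministic (counted xs xs! s refl) (counted ys ys! s′ refl) =
    ↭-length (∼bag⇒↭ (unique∧set⇒bag xs! ys! λ {x} →
      mk⇔ (from (s′ x) ∘ to (s x)) (from (s x) ∘ to (s′ x))))

  unique-map : ∀ {A B : Set} {P : A → Set} {f : A → B} →
               (∀ {x y} → P x → P y → f x ≡ f y → x ≡ y) →
               ∀ {xs} → ListAll.All P xs → List.Unique xs → List.Unique (List.map f xs)
  unique-map inj ListAll.[]         ListAllPairs.[]          = ListAllPairs.[]
  unique-map inj (p ListAll.∷ ps) (x∉xs ListAllPairs.∷ xs!) =
    ListAll.map⁺ (ListAll.zipWith (λ (q , x≢y) → x≢y ∘ inj p q) (ps , x∉xs))
    ListAllPairs.∷ unique-map inj ps xs!

  count-image : ∀ {A B : Set} {P : A → Set} {Q : B → Set} {n} (f : A → B) →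
                (∀ {x y} → P x → P y → f x ≡ f y → x ≡ y) →
                (∀ {x} → P x → Q (f x)) →
                (∀ {y} → Q y → ∃ λ x → P x × f x ≡ y) →
                Count P n → Count Q n
  count-image {P = P} {Q = Q} f inj into onto (counted xs xs! s size) =
    counted (List.map f xs)
            (unique-map inj (ListAll.tabulate (to (s _))) xs!)
            (λ y → mk⇔ image preimage)
            (trans (length-map f xs) size)
    where
    image : ∀ {y} → y ∈ List.map f xs → Q y
    image y∈ with x , x∈xs , refl ← ∈-map⁻ f y∈ = into (to (s x) x∈xs)

    preimage : ∀ {y} → Q y → y ∈ List.map f xs
    preimage q with x , p , refl ← onto q = ∈-map⁺ f (from (s x) p)

  count-resp : ∀ {A : Set} {P Q : A → Set} {n} → (∀ {x} → P x → Q x) → (∀ {x} → Q x → P x) →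
               Count P n → Count Q n
  count-resp P⇒Q Q⇒P (counted xs xs! s size) =
    counted xs xs! (λ x → mk⇔ (P⇒Q ∘ to (s x)) (from (s x) ∘ Q⇒P)) size

  count-⊎ : ∀ {A : Set} {P Q : A → Set} {m n} → (∀ {x} → P x → ¬ Q x) →
            Count P m → Count Q n → Count (λ x → P x ⊎ Q x) (m + n)
  count-⊎ disjoint (counted xs xs! s size) (counted ys ys! s′ size′) = counted (xs ++ ys)
    (ListUnique.++⁺ xs! ys! λ (x∈xs , x∈ys) → disjoint (to (s _) x∈xs) (to (s′ _) x∈ys))
    (λ x → mk⇔ ([ inj₁ ∘ to (s x) , inj₂ ∘ to (s′ x) ] ∘ ∈-++⁻ xs)
               [ ∈-++⁺ˡ ∘ from (s x) , ∈-++⁺ʳ xs ∘ from (s′ x) ])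
    (trans (length-++ xs) (cong₂ _+_ size size′))

  length-cartesianProduct : ∀ {A B : Set} (xs : List A) (ys : List B) →
                            length (cartesianProduct xs ys) ≡ length xs * length ys
  length-cartesianProduct []       ys = refl
  length-cartesianProduct (x ∷ xs) ys = trans (length-++ (List.map (x ,_) ys))
    (cong₂ _+_ (length-map (x ,_) ys) (length-cartesianProduct xs ys))

  count-× : ∀ {A B : Set} {P : A → Set} {Q : B → Set} {m n} →
            Count P m → Count Q n → Count (λ ((x , y) : A × B) → P x × Q y) (m * n)
  count-× (counted xs xs! s size) (counted ys ys! s′ size′) = counted (cartesianProduct xs ys)
    (ListUnique.cartesianProduct⁺ xs! ys!)
    (λ (x , y) → mk⇔
      (λ ∈× → let x∈xs , y∈ys = ∈-cartesianProduct⁻ xs ys ∈× in to (s x) x∈xs , to (s′ y) y∈ys)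
      (λ (p , q) → ∈-cartesianProduct⁺ (from (s x) p) (from (s′ y) q)))
    (trans (length-cartesianProduct xs ys) (cong₂ _*_ size size′))

  count-Fin : ∀ n → Count {Fin n} (λ _ → ⊤) n
  count-Fin n = counted (allFin n) (ListUnique.allFin⁺ n)
    (λ i → mk⇔ (λ _ → tt) (λ _ → ∈-allFin i)) (length-tabulate _)

  count-∅ : ∀ {A : Set} {P : A → Set} → (∀ {x} → ¬ P x) → Count P 0
  count-∅ ∅ = counted [] ListAllPairs.[] (λ x → mk⇔ (λ ()) (λ p → case ∅ p of λ ())) refl

  -- The P-elements are the images of the R-elements under the k involutions act i,
  -- and act i x determines i, so every orbit meets R exactly once.
  count-orbits : ∀ {I A : Set} {P R : A → Set} {k n} →
                 Count {I} (λ _ → ⊤) k → (act : I → A → A) →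
                 (∀ i x → act i (act i x) ≡ x) →
                 (∀ i {x} → P x → P (act i x)) →
                 (∀ {x} → R x → P x) →
                 (∀ {x} → P x → ∃ λ i → R (act i x)) →
                 (∀ {i j x} → R (act i x) → R (act j x) → i ≡ j) →
                 Count R n → Count P (k * n)
  count-orbits {P = P} {R = R} indices act act² act-P R⇒P meets once representatives =
    count-image (λ (i , x) → act i x) injective
      (λ {(i , x)} (_ , r) → act-P i (R⇒P r))
      (λ {x} p → let i , r = meets p in (i , act i x) , (tt , r) , act² i x)
      (count-× indices representatives)
    where
    injective : ∀ {ix jy} → ⊤ × R (proj₂ ix) → ⊤ × R (proj₂ jy) →
                act (proj₁ ix) (proj₂ ix) ≡ act (proj₁ jy) (proj₂ jy) → ix ≡ jy
    injective {i , x} {j , y} (_ , r) (_ , r′) eq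
      -- For z = `act i x` = `act j y`, both `act i z` = x and `act j z` = y lie in `R`, so `once`
      -- at z identifies i with j.
      with refl ← once (subst R (sym (act² i x)) r) (subst R (trans (sym (act² j y)) (cong (act j) (sym eq))) r′)
      = cong (i ,_) (trans (sym (act² i x)) (trans (cong (act i) eq) (act² i y)))

-- The 72 symmetries and the normal form of a square.

module Symmetries where

  open import Data.Fin as Fin using (Fin; zero; suc; combine; remQuot)
  open import Data.Fin.Patterns using (0F; 1F; 2F)
  open import Data.Fin.Permutation as Perm using (Permutation′; _⟨$⟩ʳ_; _⟨$⟩ˡ_)
  import Data.Fin.Properties as Fin
  open import Data.Nat using (ℕ; zero; suc; _*_; _≤_; _<_)
  open import Data.Nat.Properties
  open import Data.Nat.Solver using (module +-*-Solver)
  open import Data.Product using (∃; ∃₂; _×_; _,_; proj₁; proj₂)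
  open import Data.Product.Properties using (,-injective)
  open import Data.Sum using (_⊎_; inj₁; inj₂; [_,_]; [_,_]′)
  open import Data.Unit using (tt)
  open import Data.Vec as Vec using (Vec; []; _∷_; lookup; tabulate; concat; transpose)
  open import Data.Vec.Properties using (lookup∘tabulate; tabulate∘lookup; tabulate-cong; lookup-concat)
  open import Data.Vec.Relation.Unary.All as All using ([]; _∷_)
  import Data.Vec.Relation.Unary.All.Properties as All
  open import Data.Vec.Relation.Unary.Unique.Propositional using (Unique)
  import Data.Vec.Relation.Unary.Unique.Propositional.Properties as Unique
  open import Function using (_∘_)
  open import Relation.Binary.Definitions using (tri<; tri≈; tri>)
  open import Relation.Binary.PropositionalEquality
    using (_≡_; _≢_; refl; sym; trans; cong; cong₂; subst; subst₂)
  open import Relation.Nullary using (¬_; contradiction)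
  open import Relation.Nullary.Decidable using (from-yes)
  open import Algebra.Properties.CommutativeMonoid.Sum +-0-commutativeMonoid
    using (∑-permute) renaming (sum to ∑; sum-cong-≗ to ∑-cong)
  open Counting

  infix 9 _⟦_,_⟧

  _⟦_,_⟧ : Matrix → Fin 3 → Fin 3 → ℕ
  M ⟦ r , c ⟧ = lookup (lookup M r) c

  matrix : (Fin 3 → Fin 3 → ℕ) → Matrix
  matrix f = tabulate (λ r → tabulate (f r))

  matrix-entry : ∀ f r c → matrix f ⟦ r , c ⟧ ≡ f r c
  matrix-entry f r c = trans (cong (λ v → lookup v c) (lookup∘tabulate (λ r → tabulate (f r)) r)) (lookup∘tabulate (f r) c)

  entries-injective : ∀ {M N : Matrix} → (∀ r c → M ⟦ r , c ⟧ ≡ N ⟦ r , c ⟧) → M ≡ N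
  entries-injective {M} {N} eq = vec-ext λ r → vec-ext (eq r)
    where
    vec-ext : ∀ {A : Set} {n} {u v : Vec A n} → (∀ i → lookup u i ≡ lookup v i) → u ≡ v
    vec-ext {u = u} {v} eq = trans (sym (tabulate∘lookup u)) (trans (tabulate-cong eq) (tabulate∘lookup v))

  -- Indexing by positions lets row and column permutations and the transposition act by reindexing;
  -- distinctness becomes injectivity in the position.
  record Semimagic (t : ℕ) (M : Matrix) : Set where
    field
      positive : ∀ r c → 0 < M ⟦ r , c ⟧
      distinct : ∀ {r c r′ c′} → M ⟦ r , c ⟧ ≡ M ⟦ r′ , c′ ⟧ → (r , c) ≡ (r′ , c′)
      rows     : ∀ r → ∑ (λ c → M ⟦ r , c ⟧) ≡ t
      columns  : ∀ c → ∑ (λ r → M ⟦ r , c ⟧) ≡ t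

  column-sums : ∀ M c → Vec.sum (lookup (transpose M) c) ≡ ∑ (λ r → M ⟦ r , c ⟧)
  column-sums ((_ ∷ _ ∷ _ ∷ []) ∷ (_ ∷ _ ∷ _ ∷ []) ∷ (_ ∷ _ ∷ _ ∷ []) ∷ []) = λ where
    0F → refl
    1F → refl
    2F → refl

  row-sums : ∀ (M : Matrix) r → Vec.sum (lookup M r) ≡ ∑ (λ c → M ⟦ r , c ⟧)
  row-sums M r with _ ∷ _ ∷ _ ∷ [] ← lookup M r = refl

  semimagic⇒entrywise : ∀ {t M} → IsSemimagic t M → Semimagic t M
  semimagic⇒entrywise {t} {M} (semimagic pos dis rs cs) = record
    { positive = λ r c → subst (0 <_) (lookup-concat M r c) (All.lookup⁺ pos (combine r c))
    ; distinct = λ {r} {c} {r′} {c′} eq →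
        let r≡ , c≡ = Fin.combine-injective r c r′ c′ (Unique.lookup-injective dis (combine r c) (combine r′ c′)
                        (trans (lookup-concat M r c) (trans eq (sym (lookup-concat M r′ c′)))))
        in cong₂ _,_ r≡ c≡
    ; rows     = λ r → trans (sym (row-sums M r)) (All.lookup⁺ rs r)
    ; columns  = λ c → trans (sym (column-sums M c)) (All.lookup⁺ cs c)
    }

  entrywise⇒semimagic : ∀ {t M} → Semimagic t M → IsSemimagic t M
  entrywise⇒semimagic {t} {M} s = semimagic
    (All.lookup⁻ λ i → subst (0 <_) (sym (entry i)) (positive _ _))
    (subst Unique (tabulate∘lookup (concat M)) (Unique.tabulate⁺ λ {i} {j} eq →
      let rc = distinct (trans (sym (entry i)) (trans eq (entry j)))
      in trans (sym (Fin.combine-remQuot {3} 3 i)) (trans (cong (λ (r , c) → combine r c) rc) (Fin.combine-remQuot {3} 3 j))))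
    (All.lookup⁻ λ r → trans (row-sums M r) (rows r))
    (All.lookup⁻ λ c → trans (column-sums M c) (columns c))
    where
    open Semimagic s
    row column : Fin 9 → Fin 3
    row    = proj₁ ∘ remQuot 3
    column = proj₂ ∘ remQuot {3} 3
    entry : ∀ i → lookup (concat M) i ≡ M ⟦ row i , column i ⟧
    entry i = trans (cong (lookup (concat M)) (sym (Fin.combine-remQuot {3} 3 i))) (lookup-concat M (row i) (column i))

  permute : Permutation′ 3 → Permutation′ 3 → Matrix → Matrix
  permute ρ κ M = matrix λ r c → M ⟦ ρ ⟨$⟩ʳ r , κ ⟨$⟩ʳ c ⟧

  permute-entry : ∀ ρ κ M r c → permute ρ κ M ⟦ r , c ⟧ ≡ M ⟦ ρ ⟨$⟩ʳ r , κ ⟨$⟩ʳ c ⟧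
  permute-entry ρ κ M = matrix-entry _

  flip : Matrix → Matrix
  flip M = matrix λ r c → M ⟦ c , r ⟧

  flip-entry : ∀ M r c → flip M ⟦ r , c ⟧ ≡ M ⟦ c , r ⟧
  flip-entry M = matrix-entry _

  permutation-injective : ∀ (π : Permutation′ 3) {i j} → π ⟨$⟩ʳ i ≡ π ⟨$⟩ʳ j → i ≡ j
  permutation-injective π eq = trans (sym (Perm.inverseˡ π)) (trans (cong (π ⟨$⟩ˡ_) eq) (Perm.inverseˡ π))

  permute-semimagic : ∀ {t M} ρ κ → Semimagic t M → Semimagic t (permute ρ κ M)
  permute-semimagic {t} {M} ρ κ s = record
    { positive = λ r c → subst (0 <_) (sym (permute-entry ρ κ M r c)) (positive _ _)
    ; distinct = λ {r} {c} {r′} {c′} eq →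
        let r≡ , c≡ = ,-injective (distinct (trans (sym (permute-entry ρ κ M r c)) (trans eq (permute-entry ρ κ M r′ c′))))
        in cong₂ _,_ (permutation-injective ρ r≡) (permutation-injective κ c≡)
    ; rows     = λ r → trans (∑-cong (permute-entry ρ κ M r))
                         (trans (sym (∑-permute (λ c → M ⟦ ρ ⟨$⟩ʳ r , c ⟧) κ)) (rows _))
    ; columns  = λ c → trans (∑-cong (λ r → permute-entry ρ κ M r c))
                         (trans (sym (∑-permute (λ r → M ⟦ r , κ ⟨$⟩ʳ c ⟧) ρ)) (columns _))
    }
    where
    open Semimagic s

  flip-semimagic : ∀ {t M} → Semimagic t M → Semimagic t (flip M)
  flip-semimagic {t} {M} s = record
    { positive = λ r c → subst (0 <_) (sym (flip-entry M r c)) (positive c r)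
    ; distinct = λ {r} {c} {r′} {c′} eq →
        let c≡ , r≡ = ,-injective (distinct (trans (sym (flip-entry M r c)) (trans eq (flip-entry M r′ c′))))
        in cong₂ _,_ r≡ c≡
    ; rows     = λ r → trans (∑-cong (flip-entry M r)) (columns r)
    ; columns  = λ c → trans (∑-cong (λ r → flip-entry M r c)) (rows c)
    }
    where
    open Semimagic s


  permute-involutive : ∀ ρ κ → (∀ i → ρ ⟨$⟩ʳ (ρ ⟨$⟩ʳ i) ≡ i) → (∀ i → κ ⟨$⟩ʳ (κ ⟨$⟩ʳ i) ≡ i) →
                       ∀ M → permute ρ κ (permute ρ κ M) ≡ M
  permute-involutive ρ κ ρ² κ² M = entries-injective λ r c →
    trans (permute-entry ρ κ (permute ρ κ M) r c) (trans (permute-entry ρ κ M _ _) (cong₂ (M ⟦_,_⟧) (ρ² r) (κ² c)))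

  flip-involutive : ∀ M → flip (flip M) ≡ M
  flip-involutive M = entries-injective λ r c → trans (flip-entry (flip M) r c) (flip-entry M c r)

  swap₀ : Fin 3 → Permutation′ 3
  swap₀ p = Perm.transpose 0F p

  swap₁₂ : Permutation′ 3
  swap₁₂ = Perm.transpose 1F 2F

  swap₀-involutive : ∀ p i → swap₀ p ⟨$⟩ʳ (swap₀ p ⟨$⟩ʳ i) ≡ i
  swap₀-involutive = from-yes (Fin.all? λ p → Fin.all? λ i → swap₀ p ⟨$⟩ʳ (swap₀ p ⟨$⟩ʳ i) Fin.≟ i)

  swap₁₂-involutive : ∀ i → swap₁₂ ⟨$⟩ʳ (swap₁₂ ⟨$⟩ʳ i) ≡ i
  swap₁₂-involutive = from-yes (Fin.all? λ i → swap₁₂ ⟨$⟩ʳ (swap₁₂ ⟨$⟩ʳ i) Fin.≟ i)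

  argmin : ∀ {n} (f : Fin (suc n) → ℕ) → ∃ λ i → ∀ j → f i ≤ f j
  argmin {zero}  f = 0F , λ { 0F → ≤-refl }
  argmin {suc n} f with argmin (f ∘ suc)
  ... | i , min with ≤-total (f 0F) (f (suc i))
  ...   | inj₁ f₀≤ = 0F , λ { zero → ≤-refl ; (suc j) → ≤-trans f₀≤ (min j) }
  ...   | inj₂ ≤f₀ = suc i , λ { zero → ≤f₀ ; (suc j) → min j }

  argmin₂ : ∀ {m n} (f : Fin (suc m) → Fin (suc n) → ℕ) → ∃₂ λ i j → ∀ k l → f i j ≤ f k l
  argmin₂ f with argmin (λ i → f i (proj₁ (argmin (f i))))
  ... | i , min = i , proj₁ (argmin (f i)) , λ k l → ≤-trans (min k) (proj₂ (argmin (f k)) l)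

  -- Distinctness removes the middle case of trichotomy, so each order condition below holds for
  -- exactly one of a square and its mirror image.
  entries-comparable : ∀ {t M r c r′ c′} → Semimagic t M → (r , c) ≢ (r′ , c′) →
                       M ⟦ r , c ⟧ < M ⟦ r′ , c′ ⟧ ⊎ M ⟦ r′ , c′ ⟧ < M ⟦ r , c ⟧
  entries-comparable s neq with <-cmp _ _
  ... | tri< lt _ _ = inj₁ lt
  ... | tri≈ _ eq _ = contradiction (Semimagic.distinct s eq) neq
  ... | tri> _ _ gt = inj₂ gt

  count-halves : ∀ {A : Set} {P R : A → Set} {n} (τ : A → A) → (∀ x → τ (τ x) ≡ x) →
                 (∀ {x} → P x → P (τ x)) → (∀ {x} → R x → P x) →
                 (∀ {x} → P x → R x ⊎ R (τ x)) → (∀ {x} → R x → ¬ R (τ x)) →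
                 Count R n → Count P (2 * n)
  count-halves {R = R} τ τ² P-τ R⇒P choose exclusive = count-orbits (count-Fin 2) act
    (λ { 0F x → refl ; 1F x → τ² x })
    (λ { 0F p → p ; 1F p → P-τ p })
    R⇒P
    (λ p → [ (λ r → 0F , r) , (λ r → 1F , r) ]′ (choose p))
    (λ { {0F} {0F} r r′ → refl ; {1F} {1F} r r′ → refl
       ; {0F} {1F} r r′ → contradiction r′ (exclusive r) ; {1F} {0F} r r′ → contradiction r (exclusive r′) })
    where
    act : Fin 2 → _ → _
    act 0F x = x
    act 1F x = τ x

  module _ (t : ℕ) where

    -- The factor 72 arises as 9 · 2 · 2 · 2 along four nested conditions. They are ordered so that
    -- the symmetry used for each of the last three preserves the conditions imposed before it.
    record LeastFirst (M : Matrix) : Set where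
      constructor leastFirst
      field
        isSemimagic : Semimagic t M
        least       : ∀ r c → M ⟦ 0F , 0F ⟧ ≤ M ⟦ r , c ⟧

    record ColumnsOrdered (M : Matrix) : Set where
      constructor columnsOrdered
      field
        isLeastFirst : LeastFirst M
        column-order : M ⟦ 0F , 1F ⟧ < M ⟦ 0F , 2F ⟧

    record RowsOrdered (M : Matrix) : Set where
      constructor rowsOrdered
      field
        isColumnsOrdered : ColumnsOrdered M
        row-order        : M ⟦ 1F , 0F ⟧ < M ⟦ 2F , 0F ⟧

    record Normal (M : Matrix) : Set where
      constructor normal
      field
        isRowsOrdered  : RowsOrdered M
        diagonal-order : M ⟦ 0F , 1F ⟧ < M ⟦ 1F , 0F ⟧

    moveLeast : Fin 3 × Fin 3 → Matrix → Matrix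
    moveLeast (p , q) = permute (swap₀ p) (swap₀ q)

    least-position : ∀ {p q M} → LeastFirst (moveLeast (p , q) M) → ∀ r c → M ⟦ p , q ⟧ ≤ M ⟦ r , c ⟧
    least-position {p} {q} {M} (leastFirst _ least) r c =
      subst (M ⟦ p , q ⟧ ≤_)
        (trans (permute-entry (swap₀ p) (swap₀ q) M (swap₀ p ⟨$⟩ʳ r) (swap₀ q ⟨$⟩ʳ c))
          (cong₂ (M ⟦_,_⟧) (swap₀-involutive p r) (swap₀-involutive q c)))
        (least (swap₀ p ⟨$⟩ʳ r) (swap₀ q ⟨$⟩ʳ c))

    permute-leastFirst : ∀ {M} ρ κ → ρ ⟨$⟩ʳ 0F ≡ 0F → κ ⟨$⟩ʳ 0F ≡ 0F → LeastFirst M → LeastFirst (permute ρ κ M)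
    permute-leastFirst {M} ρ κ ρ₀ κ₀ (leastFirst s least) = leastFirst (permute-semimagic ρ κ s) λ r c →
      subst₂ _≤_ (sym (cong₂ (M ⟦_,_⟧) ρ₀ κ₀)) (sym (permute-entry ρ κ M r c)) (least _ _)

    count-leastFirst : ∀ {n} → Count LeastFirst n → Count (Semimagic t) (9 * n)
    count-leastFirst = count-orbits (count-resp proj₁ (λ _ → tt , tt) (count-× (count-Fin 3) (count-Fin 3)))
      moveLeast
      (λ (p , q) → permute-involutive (swap₀ p) (swap₀ q) (swap₀-involutive p) (swap₀-involutive q))
      (λ (p , q) → permute-semimagic (swap₀ p) (swap₀ q))
      LeastFirst.isSemimagic
      (λ {M} s → let p , q , min = argmin₂ (M ⟦_,_⟧) in
        (p , q) , leastFirst (permute-semimagic (swap₀ p) (swap₀ q) s)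
          (λ r c → subst (M ⟦ p , q ⟧ ≤_) (sym (permute-entry (swap₀ p) (swap₀ q) M r c)) (min _ _)))
      -- Both positions carry the least entry of the unmoved matrix, and a value occurs only once.
      -- That this matrix is semimagic is recovered by undoing the move.
      (λ {i} {j} {M} l l′ → Semimagic.distinct (semimagic-unmoved i {M} l)
        (≤-antisym (least-position {M = M} l _ _) (least-position {M = M} l′ _ _)))
      where
      semimagic-unmoved : ∀ i {M} → LeastFirst (moveLeast i M) → Semimagic t M
      semimagic-unmoved (p , q) {M} l =
        subst (Semimagic t) (permute-involutive (swap₀ p) (swap₀ q) (swap₀-involutive p) (swap₀-involutive q) M)
          (permute-semimagic (swap₀ p) (swap₀ q) (LeastFirst.isSemimagic l))

    count-columnsOrdered : ∀ {n} → Count ColumnsOrdered n → Count LeastFirst (2 * n)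
    count-columnsOrdered = count-halves (permute Perm.id swap₁₂)
      (permute-involutive Perm.id swap₁₂ (λ _ → refl) swap₁₂-involutive)
      step
      ColumnsOrdered.isLeastFirst
      (λ l → [ (λ lt → inj₁ (columnsOrdered l lt)) , (λ gt → inj₂ (columnsOrdered (step l) gt)) ]
               (entries-comparable (LeastFirst.isSemimagic l) λ ()))
      (λ (columnsOrdered _ lt) (columnsOrdered _ gt) → <-asym lt gt)
      where
      step : ∀ {M} → LeastFirst M → LeastFirst (permute Perm.id swap₁₂ M)
      step = permute-leastFirst Perm.id swap₁₂ refl refl

    count-rowsOrdered : ∀ {n} → Count RowsOrdered n → Count ColumnsOrdered (2 * n)
    count-rowsOrdered = count-halves (permute swap₁₂ Perm.id)
      (permute-involutive swap₁₂ Perm.id swap₁₂-involutive (λ _ → refl))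
      step
      RowsOrdered.isColumnsOrdered
      (λ l → [ (λ lt → inj₁ (rowsOrdered l lt)) , (λ gt → inj₂ (rowsOrdered (step l) gt)) ]
               (entries-comparable (LeastFirst.isSemimagic (ColumnsOrdered.isLeastFirst l)) λ ()))
      (λ (rowsOrdered _ lt) (rowsOrdered _ gt) → <-asym lt gt)
      where
      step : ∀ {M} → ColumnsOrdered M → ColumnsOrdered (permute swap₁₂ Perm.id M)
      -- The column order concerns row 0 only, which this exchange of rows fixes, so `lt` still
      -- proves it.
      step (columnsOrdered l lt) = columnsOrdered (permute-leastFirst swap₁₂ Perm.id refl refl l) lt

    count-normal : ∀ {n} → Count Normal n → Count RowsOrdered (2 * n)
    count-normal = count-halves flip flip-involutive
      step
      Normal.isRowsOrdered
      (λ l → [ (λ lt → inj₁ (normal l lt)) , (λ gt → inj₂ (normal (step l) gt)) ]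
               (entries-comparable (LeastFirst.isSemimagic (ColumnsOrdered.isLeastFirst (RowsOrdered.isColumnsOrdered l))) λ ()))
      (λ (normal _ lt) (normal _ gt) → <-asym lt gt)
      where
      step : ∀ {M} → RowsOrdered M → RowsOrdered (flip M)
      -- Transposition interchanges the two order conditions: `lt′` becomes the column order and
      -- `lt` the row order.
      step {M} (rowsOrdered (columnsOrdered (leastFirst s least) lt) lt′) = rowsOrdered (columnsOrdered
        (leastFirst (flip-semimagic s) (λ r c → subst (_ ≤_) (sym (flip-entry M r c)) (least c r))) lt′) lt

  count-72 : ∀ {t n} → Count (Normal t) n → Sₐ t ≡ 72 * n
  count-72 {t} {n} c = trans
    (count-deterministic squares
      (count-leastFirst t (count-columnsOrdered t (count-rowsOrdered t (count-normal t c)))))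
    (solve 1 (λ n → con 9 :* (con 2 :* (con 2 :* (con 2 :* n))) := con 72 :* n) refl n)
    where
    open +-*-Solver
    squares : Count (Semimagic t) (Sₐ t)
    squares = count-resp semimagic⇒entrywise entrywise⇒semimagic
      (counted (semimagicSquares t) (semimagicSquares-unique t) (∈-semimagicSquares t) refl)

-- Lattice points of decomposed cones, and denumerants.

module Cones where

  open import Data.Fin using (Fin; zero; suc)
  open import Data.List as List using (List; []; _∷_; _++_; length; upTo; filter)
  open import Data.List.Membership.Propositional.Properties using (∈-filter⁺; ∈-filter⁻)
  open import Data.List.Properties using (map-++)
  import Data.List.Relation.Unary.Unique.Propositional.Properties as ListUnique
  open import Data.Nat using (>-nonZero; ℕ; zero; suc; _+_; _*_; _∸_; _≤_; _<_; z≤n; s≤s; _≟_; _≤?_; _<?_)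
  open import Data.Nat.ListAction using (sum)
  open import Data.Nat.ListAction.Properties using (sum-++)
  open import Data.Nat.Properties
  open import Data.Nat.Solver using (module +-*-Solver)
  open import Data.Product using (Σ; ∃; _×_; _,_; proj₁; proj₂)
  open import Data.Sum using (_⊎_; inj₁; inj₂; [_,_])
  open import Data.Vec using (Vec; []; _∷_; lookup; removeAt; insertAt; map; head)
  open import Data.Vec.Properties
    using (map-∘; map-cong; ≡-dec; insertAt-removeAt; removeAt-insertAt; insertAt-lookup; ∷-injective)
  open import Data.Vec.Relation.Binary.Pointwise.Inductive as Pointwise using (Pointwise; []; _∷_)
  open import Data.Vec.Relation.Unary.All as All using (All; []; _∷_; all?)
  import Data.Vec.Relation.Unary.All.Properties as All
  open import Data.Vec.Relation.Unary.AllPairs as AllPairs using ([]; _∷_; allPairs?)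
  import Data.Vec.Relation.Unary.AllPairs.Properties as AllPairs
  open import Data.Vec.Relation.Unary.Unique.Propositional using (Unique)
  open import Function using (_∘_; mk⇔; case_of_)
  open import Relation.Binary.Definitions using (tri<; tri≈; tri>)
  open import Relation.Binary.PropositionalEquality
    using (_≡_; _≢_; refl; sym; trans; cong; cong₂; subst; module ≡-Reasoning)
  open import Relation.Nullary using (¬_)
  open import Relation.Nullary.Decidable
    using (Dec; True; False; toWitness; toWitnessFalse; _×-dec_; _⊎-dec_; ¬?)
  open Counting

  infix 7 _·_

  _·_ : ∀ {n} → Vec ℕ n → Vec ℕ n → ℕ
  []       · []       = 0
  (w ∷ ws) · (a ∷ as) = w * a + ws · as

  record Solution {n k} (w : Vec ℕ n) (fs : Vec (Vec ℕ n) k) (t : ℕ) (a : Vec ℕ n) : Set where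
    constructor solution
    field
      positive : All (0 <_) a
      total    : w · a ≡ t
      distinct : Unique (map (_· a) fs)

  -- The forms change by the transpose of the map on points, which preserves the total and all
  -- values of forms. Positivity is the only condition that does not transport by itself and is
  -- supplied separately each time.
  module Substitution {m n : ℕ} (f : Vec ℕ n → Vec ℕ m) (g : Vec ℕ m → Vec ℕ n)
                      (adjoint : ∀ v a → v · g a ≡ f v · a) where

    values : ∀ {k} (fs : Vec (Vec ℕ n) k) a → map (_· a) (map f fs) ≡ map (_· g a) fs
    values fs a = trans (sym (map-∘ (_· a) f fs)) (map-cong (λ v → sym (adjoint v a)) fs)

    push : ∀ {k w t a} {fs : Vec (Vec ℕ n) k} → All (0 <_) (g a) →
           Solution (f w) (map f fs) t a → Solution w fs t (g a)
    push {w = w} {a = a} {fs} pos (solution _ total distinct) =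
      solution pos (trans (adjoint w a) total) (subst Unique (values fs a) distinct)

    pull : ∀ {k w t a} {fs : Vec (Vec ℕ n) k} → All (0 <_) a →
           Solution w fs t (g a) → Solution (f w) (map f fs) t a
    pull {w = w} {a = a} {fs} pos (solution _ total distinct) =
      solution pos (trans (sym (adjoint w a)) total) (subst Unique (sym (values fs a)) distinct)

  front : ∀ {A : Set} {n} → Fin (suc n) → Vec A (suc n) → Vec A (suc n)
  front p v = lookup v p ∷ removeAt v p

  unfront : ∀ {A : Set} {n} → Fin (suc n) → Vec A (suc n) → Vec A (suc n)
  unfront p (x ∷ v) = insertAt v p x

  front-unfront : ∀ {A : Set} {n} (p : Fin (suc n)) (v : Vec A (suc n)) → front p (unfront p v) ≡ v
  front-unfront p (x ∷ v) = cong₂ _∷_ (insertAt-lookup v p x) (removeAt-insertAt v p x)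

  unfront-front : ∀ {A : Set} {n} (p : Fin (suc n)) (v : Vec A (suc n)) → unfront p (front p v) ≡ v
  unfront-front p v = insertAt-removeAt v p

  -- For a permutation of coordinates the transpose is the inverse, so `front` serves for points and
  -- for forms.
  front-adjoint : ∀ {n} (p : Fin (suc n)) v a → v · unfront p a ≡ front p v · a
  front-adjoint zero    (v ∷ vs)          (a ∷ as)      = refl
  front-adjoint (suc p) (v ∷ vs@(_ ∷ _)) (a ∷ b ∷ as) = begin
    v * b + vs · insertAt as p a                        ≡⟨ cong (v * b +_) (front-adjoint p vs (a ∷ as)) ⟩
    v * b + (lookup vs p * a + removeAt vs p · as)      ≡⟨ swap (v * b) (lookup vs p * a) (removeAt vs p · as) ⟩
    lookup vs p * a + (v * b + removeAt vs p · as)      ∎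
    where
    open ≡-Reasoning
    swap : ∀ x y z → x + (y + z) ≡ y + (x + z)
    swap x y z = trans (sym (+-assoc x y z)) (trans (cong (_+ z) (+-comm x y)) (+-assoc y x z))

  lookup-positive : ∀ {n} (p : Fin (suc n)) {a : Vec ℕ (suc n)} → All (0 <_) a → All (0 <_) (front p a)
  lookup-positive zero    pos@(_ ∷ _)            = pos
  lookup-positive (suc p) {_ ∷ _ ∷ _} (q ∷ pos) with r ∷ rs ← lookup-positive p pos = r ∷ q ∷ rs

  unfront-positive : ∀ {n} (p : Fin (suc n)) {a : Vec ℕ (suc n)} → All (0 <_) a → All (0 <_) (unfront p a)
  unfront-positive zero    (q ∷ pos)      = q ∷ pos
  unfront-positive (suc p) (q ∷ r ∷ pos)  = r ∷ unfront-positive p (q ∷ pos)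

  count-front : ∀ {n k N t} {w : Vec ℕ (suc n)} {fs : Vec (Vec ℕ (suc n)) k} p →
                Count (Solution (front p w) (map (front p) fs) t) N → Count (Solution w fs t) N
  count-front {w = w} {fs} p = count-image (unfront p)
    (λ _ _ eq → trans (sym (front-unfront p _)) (trans (cong (front p) eq) (front-unfront p _)))
    (λ s → push (unfront-positive p (Solution.positive s)) s)
    (λ {a} s → front p a ,
       pull (lookup-positive p (Solution.positive s)) (subst (Solution w fs _) (sym (unfront-front p a)) s) ,
       unfront-front p a)
    where open Substitution (front p) (unfront p) (front-adjoint p)

  -- On the region x < y put y = x + y′, on y < x put x = y + x′, on x = y drop y;
  -- the linear forms change by the transposed substitutions.

  lessForm greaterForm : ∀ {n} → Vec ℕ (suc (suc n)) → Vec ℕ (suc (suc n))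
  lessForm    (u ∷ v ∷ vs) = u + v ∷ v ∷ vs
  greaterForm (u ∷ v ∷ vs) = u ∷ u + v ∷ vs

  equalForm : ∀ {n} → Vec ℕ (suc (suc n)) → Vec ℕ (suc n)
  equalForm   (u ∷ v ∷ vs) = u + v ∷ vs

  less greater : ∀ {n} → Vec ℕ (suc (suc n)) → Vec ℕ (suc (suc n))
  less    (x ∷ y ∷ as) = x ∷ x + y ∷ as
  greater (x ∷ y ∷ as) = x + y ∷ y ∷ as

  equal : ∀ {n} → Vec ℕ (suc n) → Vec ℕ (suc (suc n))
  equal   (x ∷ as)     = x ∷ x ∷ as

  less-adjoint : ∀ {n} (v a : Vec ℕ (suc (suc n))) → v · less a ≡ lessForm v · a
  less-adjoint (u ∷ v ∷ vs) (x ∷ y ∷ as) =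
    solve 5 (λ u v x y z → u :* x :+ (v :* (x :+ y) :+ z) := (u :+ v) :* x :+ (v :* y :+ z)) refl u v x y (vs · as)
    where open +-*-Solver

  greater-adjoint : ∀ {n} (v a : Vec ℕ (suc (suc n))) → v · greater a ≡ greaterForm v · a
  greater-adjoint (u ∷ v ∷ vs) (x ∷ y ∷ as) =
    solve 5 (λ u v x y z → u :* (x :+ y) :+ (v :* y :+ z) := u :* x :+ ((u :+ v) :* y :+ z)) refl u v x y (vs · as)
    where open +-*-Solver

  equal-adjoint : ∀ {n} (v : Vec ℕ (suc (suc n))) (a : Vec ℕ (suc n)) → v · equal a ≡ equalForm v · a
  equal-adjoint (u ∷ v ∷ vs) (x ∷ as) =
    solve 4 (λ u v x z → u :* x :+ (v :* x :+ z) := (u :+ v) :* x :+ z) refl u v x (vs · as)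
    where open +-*-Solver

  module _ {n k t : ℕ} {w : Vec ℕ (suc (suc n))} {fs : Vec (Vec ℕ (suc (suc n))) k} where

    Less Greater Equal : Vec ℕ (suc (suc n)) → Set
    Less    a@(x ∷ y ∷ _) = x < y × Solution w fs t a
    Greater a@(x ∷ y ∷ _) = y < x × Solution w fs t a
    Equal   a@(x ∷ y ∷ _) = x ≡ y × Solution w fs t a

    count-less : ∀ {N} → Count (Solution (lessForm w) (map lessForm fs) t) N → Count Less N
    count-less = count-image less
      (λ { {x ∷ y ∷ _} {_ ∷ _ ∷ _} _ _ eq →
           let x≡ , eq′ = ∷-injective eq; y≡ , as≡ = ∷-injective eq′ in
           cong₂ _∷_ x≡ (cong₂ _∷_ (+-cancelˡ-≡ x _ _ (trans y≡ (cong (_+ _) (sym x≡)))) as≡) })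
      (λ { {x ∷ y ∷ _} s@(solution (p ∷ q ∷ ps) _ _) → m<m+n x q , push (p ∷ ≤-trans p (m≤m+n x y) ∷ ps) s })
      (λ { {x ∷ y ∷ as} (x<y , s@(solution (p ∷ q ∷ ps) _ _)) →
           let eq = cong (λ z → x ∷ z ∷ as) (m+[n∸m]≡n (<⇒≤ x<y)) in
           (x ∷ y ∸ x ∷ as) , pull (p ∷ m<n⇒0<n∸m x<y ∷ ps) (subst (Solution w fs t) (sym eq) s) , eq })
      where open Substitution lessForm less less-adjoint

    count-greater : ∀ {N} → Count (Solution (greaterForm w) (map greaterForm fs) t) N → Count Greater N
    count-greater = count-image greater
      (λ { {x ∷ y ∷ _} {_ ∷ _ ∷ _} _ _ eq →
           let x≡ , eq′ = ∷-injective eq; y≡ , as≡ = ∷-injective eq′ in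
           cong₂ _∷_ (+-cancelʳ-≡ y _ _ (trans x≡ (cong (_ +_) (sym y≡)))) (cong₂ _∷_ y≡ as≡) })
      (λ { {x ∷ y ∷ _} s@(solution (p ∷ q ∷ ps) _ _) → m<n+m y p , push (≤-trans p (m≤m+n x y) ∷ q ∷ ps) s })
      (λ { {x ∷ y ∷ as} (y<x , s@(solution (p ∷ q ∷ ps) _ _)) →
           let eq = cong (λ z → z ∷ y ∷ as) (m∸n+n≡m (<⇒≤ y<x)) in
           (x ∸ y ∷ y ∷ as) , pull (m<n⇒0<n∸m y<x ∷ q ∷ ps) (subst (Solution w fs t) (sym eq) s) , eq })
      where open Substitution greaterForm greater greater-adjoint

    count-equal : ∀ {N} → Count (Solution (equalForm w) (map equalForm fs) t) N → Count Equal N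
    count-equal = count-image equal
      (λ { {_ ∷ _} {_ ∷ _} _ _ refl → refl })
      (λ { {_ ∷ _} s@(solution (p ∷ ps) _ _) → refl , push (p ∷ p ∷ ps) s })
      (λ { {x ∷ _ ∷ as} (refl , s@(solution (p ∷ _ ∷ ps) _ _)) → (x ∷ as) , pull (p ∷ ps) s , refl })
      where open Substitution equalForm equal equal-adjoint

    count-split : ∀ {N₁ N₂ N₃} →
                  Count (Solution (lessForm w) (map lessForm fs) t) N₁ →
                  Count (Solution (greaterForm w) (map greaterForm fs) t) N₂ →
                  Count (Solution (equalForm w) (map equalForm fs) t) N₃ →
                  Count (Solution w fs t) (N₁ + (N₂ + N₃))
    count-split l g e = count-resp
      (λ { {_ ∷ _ ∷ _} (inj₁ (_ , s))        → s
         ; {_ ∷ _ ∷ _} (inj₂ (inj₁ (_ , s))) → s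
         ; {_ ∷ _ ∷ _} (inj₂ (inj₂ (_ , s))) → s })
      (λ { {x ∷ y ∷ _} s → case <-cmp x y of λ where
             (tri< x<y _ _) → inj₁ (x<y , s)
             (tri≈ _ x≡y _) → inj₂ (inj₂ (x≡y , s))
             (tri> _ _ y<x) → inj₂ (inj₁ (y<x , s)) })
      (count-⊎ (λ { {_ ∷ _ ∷ _} (x<y , _) (inj₁ (y<x , _)) → <-asym x<y y<x
                  ; {_ ∷ _ ∷ _} (x<y , _) (inj₂ (x≡y , _)) → <⇒≢ x<y x≡y })
               (count-less l)
               (count-⊎ (λ { {_ ∷ _ ∷ _} (y<x , _) (x≡y , _) → <⇒≢ y<x (sym x≡y) })
                        (count-greater g) (count-equal e)))

  positiveSolution? : ∀ {n} (w : Vec ℕ n) t a → Dec (All (0 <_) a × w · a ≡ t)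
  positiveSolution? w t a = all? (0 <?_) a ×-dec (w · a ≟ t)

  -- Every part is used at least once.
  denumerant : ∀ {n} → Vec ℕ n → ℕ → ℕ
  denumerant {n} w t = length (filter (positiveSolution? w t) (vectors (List.map suc (upTo t)) n))

  -- Positive weights bound every entry by the total, which makes the finite search in `denumerant`
  -- complete.
  entry≤· : ∀ {n} {w a : Vec ℕ n} → All (0 <_) w → All (_≤ w · a) a
  entry≤· {a = []}                   _        = []
  entry≤· {w = w ∷ ws} {a = a ∷ as} (p ∷ ps) =
    ≤-trans (m≤n*m a w {{>-nonZero p}}) (m≤m+n (w * a) (ws · as)) ∷
    All.map (λ q → ≤-trans q (m≤n+m (ws · as) (w * a))) (entry≤· ps)

  count-denumerant : ∀ {n} {w : Vec ℕ n} → All (0 <_) w → ∀ t → Count (Solution w [] t) (denumerant w t)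
  count-denumerant {n} {w} w>0 t = counted (filter (positiveSolution? w t) candidates)
    (ListUnique.filter⁺ (positiveSolution? w t)
      (vectors-unique (ListUnique.map⁺ suc-injective (ListUnique.upTo⁺ t)) n))
    (λ a → mk⇔
      (λ a∈ → let _ , pos , eq = ∈-filter⁻ (positiveSolution? w t) {xs = candidates} a∈ in solution pos eq [])
      (λ { (solution pos refl _) → ∈-filter⁺ (positiveSolution? w t)
             (∈-vectors (All.map (λ (p , q) → ∈-range p q) (All.zip (pos , entry≤· w>0)))) (pos , refl) }))
    refl
    where
    candidates = vectors (List.map suc (upTo t)) n

  denumerant-below : ∀ {n w t} {ws : Vec ℕ n} → All (0 <_) (w ∷ ws) → t < w → denumerant (w ∷ ws) t ≡ 0
  denumerant-below {w = w} {t} {ws} w>0 t<w = count-deterministic (count-denumerant w>0 t) (count-∅ none)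
    where
    none : ∀ {a} → ¬ Solution (w ∷ ws) [] t a
    none {a ∷ as} (solution (p ∷ _) refl _) =
      <⇒≱ t<w (≤-trans (m≤m*n w a {{>-nonZero p}}) (m≤m+n (w * a) (ws · as)))

  -- Either the part w is used exactly once, or one use of it can be dropped.
  denumerant-step : ∀ {n w} {ws : Vec ℕ n} → All (0 <_) (w ∷ ws) → ∀ t →
                    denumerant (w ∷ ws) (w + t) ≡ denumerant ws t + denumerant (w ∷ ws) t
  denumerant-step {n} {w} {ws} w>0@(_ ∷ ws>0) t =
    count-deterministic (count-denumerant w>0 (w + t))
      (count-resp [ proj₁ , proj₁ ] cases (count-⊎ exclusive
        (count-image (1 ∷_) (λ _ _ eq → proj₂ (∷-injective eq))
          (λ { (solution pos refl _) → solution (s≤s z≤n ∷ pos) (cong (_+ _) (*-identityʳ w)) [] , refl })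
          (λ { {_ ∷ as} (solution (_ ∷ pos) eq _ , refl) → as ,
               solution pos (+-cancelˡ-≡ w _ _ (trans (cong (_+ _) (sym (*-identityʳ w))) eq)) [] , refl })
          (count-denumerant ws>0 t))
        (count-image (λ { (x ∷ as) → suc x ∷ as })
          (λ { {_ ∷ _} {_ ∷ _} _ _ refl → refl })
          (λ { {x ∷ as} (solution (p ∷ pos) refl _) → solution (s≤s z≤n ∷ pos) (dropped x as) [] , s≤s p })
          (λ { {suc x ∷ as} (solution (_ ∷ pos) eq _ , s≤s p) → x ∷ as ,
               solution (p ∷ pos) (+-cancelˡ-≡ w _ _ (trans (sym (dropped x as)) eq)) [] , refl })
          (count-denumerant w>0 t))))
    where
    Once More : Vec ℕ (suc n) → Set
    Once a = Solution (w ∷ ws) [] (w + t) a × head a ≡ 1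
    More a = Solution (w ∷ ws) [] (w + t) a × 1 < head a

    dropped : ∀ x (as : Vec ℕ n) → w * suc x + ws · as ≡ w + (w * x + ws · as)
    dropped x as = trans (cong (_+ ws · as) (*-suc w x)) (+-assoc w (w * x) (ws · as))

    exclusive : ∀ {a} → Once a → ¬ More a
    exclusive (_ , a≡1) (_ , 1<a) = <⇒≢ 1<a (sym a≡1)

    cases : ∀ {a} → Solution (w ∷ ws) [] (w + t) a → Once a ⊎ More a
    cases {1 ∷ _}           s = inj₁ (s , refl)
    cases {suc (suc _) ∷ _} s = inj₂ (s , s≤s (s≤s z≤n))
    cases {0 ∷ _} (solution (() ∷ _) _ _)

  -- The decidable criterion for two forms to differ on the whole open orthant: their difference is
  -- nonzero with coefficients of one sign.
  Comparable : ∀ {n} → Vec ℕ n → Vec ℕ n → Set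
  Comparable f g = (Pointwise _≤_ f g ⊎ Pointwise _≤_ g f) × f ≢ g

  comparable? : ∀ {n} (f g : Vec ℕ n) → Dec (Comparable f g)
  comparable? f g = (Pointwise.decidable _≤?_ f g ⊎-dec Pointwise.decidable _≤?_ g f) ×-dec ¬? (≡-dec _≟_ f g)

  ·-mono : ∀ {n} {f g a : Vec ℕ n} → Pointwise _≤_ f g → f · a ≤ g · a
  ·-mono {a = []}    []       = ≤-refl
  ·-mono {a = a ∷ _} (p ∷ ps) = +-mono-≤ (*-monoˡ-≤ a p) (·-mono ps)

  -- Domination makes each summand on the left at most the one on the right, so equal totals force
  -- equal summands, and strictly positive coordinates can be cancelled.
  ·-cancel : ∀ {n} {f g a : Vec ℕ n} → Pointwise _≤_ f g → All (0 <_) a → f · a ≡ g · a → f ≡ g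
  ·-cancel []       []         _  = refl
  ·-cancel {f = x ∷ f} {y ∷ g} {a ∷ as} (p ∷ ps) (q ∷ qs) eq =
    cong₂ _∷_ (*-cancelʳ-≡ x y a {{>-nonZero q}} heads)
              (·-cancel ps qs (+-cancelˡ-≡ (x * a) _ _ (trans eq (cong (_+ g · as) (sym heads)))))
    where
    heads : x * a ≡ y * a
    heads = ≤-antisym (*-monoˡ-≤ a p)
      (+-cancelʳ-≤ (g · as) _ _ (≤-trans (≤-reflexive (sym eq)) (+-monoʳ-≤ (x * a) (·-mono ps))))

  comparable⇒≢ : ∀ {n} {f g a : Vec ℕ n} → All (0 <_) a → Comparable f g → f · a ≢ g · a
  comparable⇒≢ pos (inj₁ f≤g , f≢g) eq = f≢g (·-cancel f≤g pos eq)
  comparable⇒≢ pos (inj₂ g≤f , f≢g) eq = f≢g (sym (·-cancel g≤f pos (sym eq)))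

  unique? : ∀ {n k} (fs : Vec (Vec ℕ n) k) → Dec (Unique fs)
  unique? = allPairs? (λ f g → ¬? (≡-dec _≟_ f g))

  unique-map⁻ : ∀ {A B : Set} {f : A → B} {n} {xs : Vec A n} → Unique (map f xs) → Unique xs
  unique-map⁻ {xs = []}    []       = []
  unique-map⁻ {f = f} {xs = _ ∷ _} (p ∷ ps) = All.map (_∘ cong f) (All.map⁻ p) ∷ unique-map⁻ ps

  -- A decomposition of the positive orthant into simplicial cones; on each of them the
  -- forms fs are either everywhere distinct (leaf) or not distinct at all (void).
  data Decomposition {k : ℕ} : ∀ {n} → Vec ℕ n → Vec (Vec ℕ n) k → Set where
    leaf  : ∀ {n} {w : Vec ℕ n} {fs} {_ : True (all? (0 <?_) w)} {_ : True (allPairs? comparable? fs)} →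
            Decomposition w fs
    void  : ∀ {n} {w : Vec ℕ n} {fs} {_ : False (unique? fs)} → Decomposition w fs
    fore  : ∀ {n} {w : Vec ℕ (suc n)} {fs} (p : Fin (suc n)) →
            Decomposition (front p w) (map (front p) fs) → Decomposition w fs
    split : ∀ {n} {w : Vec ℕ (suc (suc n))} {fs} →
            Decomposition (lessForm w) (map lessForm fs) →
            Decomposition (greaterForm w) (map greaterForm fs) →
            Decomposition (equalForm w) (map equalForm fs) →
            Decomposition w fs

  Weights : Set
  Weights = ∃ λ n → Σ (Vec ℕ n) (All (0 <_))

  leaves : ∀ {n k} {w : Vec ℕ n} {fs : Vec (Vec ℕ n) k} → Decomposition w fs → List Weights
  leaves (leaf {w = w} {_} {w>0}) = (_ , w , toWitness w>0) ∷ []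
  leaves void                     = []
  leaves (fore p d)               = leaves d
  leaves (split l g e)            = leaves l ++ (leaves g ++ leaves e)

  solutions : List Weights → ℕ → ℕ
  solutions ws t = sum (List.map (λ (_ , w , _) → denumerant w t) ws)

  solutions-++ : ∀ vs ws t → solutions (vs ++ ws) t ≡ solutions vs t + solutions ws t
  solutions-++ vs ws t = trans (cong sum (map-++ _ vs ws)) (sum-++ (List.map _ vs) _)

  count-leaves : ∀ {n k} {w : Vec ℕ n} {fs : Vec (Vec ℕ n) k} (d : Decomposition w fs) t →
                 Count (Solution w fs t) (solutions (leaves d) t)
  count-leaves (leaf {w = w} {_} {w>0} {comparable}) t = subst (Count _) (sym (+-identityʳ _)) (count-resp
    (λ (solution pos eq _) → solution pos eq
       (AllPairs.map⁺ (AllPairs.map (comparable⇒≢ pos) (toWitness comparable))))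
    (λ (solution pos eq _) → solution pos eq [])
    (count-denumerant (toWitness w>0) t))
  count-leaves (void {_} {_} {_} {notUnique}) t =
    -- Two forms that coincide as vectors take equal values at every point, so no point of this cone
    -- gives distinct entries.
    count-∅ λ s → toWitnessFalse notUnique (unique-map⁻ (Solution.distinct s))
  count-leaves (fore p d) t = count-front p (count-leaves d t)
  count-leaves (split l g e) t = subst (Count _)
    (sym (trans (solutions-++ (leaves l) _ t) (cong (solutions (leaves l) t +_) (solutions-++ (leaves g) _ t))))
    (count-split (count-leaves l t) (count-leaves g t) (count-leaves e t))

-- Linear parametrisation of normal squares and the cone decomposition.

module NormalForm where

  open import Data.Fin as Fin using (Fin)
  open import Data.Fin.Patterns using (0F; 1F; 2F; 3F)
  import Data.Fin.Properties as Fin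
  open import Data.Nat using (ℕ; _+_; _*_; _∸_; _≤_; _<_; _≟_; _≤?_)
  open import Data.Nat.Properties
  open import Data.Nat.Solver using (module +-*-Solver)
  open import Data.Product using (_,_)
  open import Data.Vec as Vec using (Vec; []; _∷_; lookup; concat; map; transpose)
  open import Data.Vec.Properties using (map-concat; lookup-map; ≡-dec)
  open import Data.Vec.Relation.Binary.Pointwise.Inductive as Pointwise using (Pointwise; []; _∷_)
  open import Data.Vec.Relation.Unary.All as All using (All; []; _∷_)
  import Data.Vec.Relation.Unary.All.Properties as All
  open import Data.Vec.Relation.Unary.Unique.Propositional using (Unique)
  open import Function using (_∘_; case_of_)
  open import Relation.Binary.PropositionalEquality using (_≡_; refl; sym; trans; cong; cong₂; subst)
  open import Relation.Nullary.Decidable using (True; False; toWitness; toWitnessFalse; from-yes)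
  open Counting
  open Symmetries
  open Cones

  -- A normal square is determined by i, f, k, l, m ≥ 1: m is its least entry, m + i and m + f
  -- are the last entries of the other two rows, and k, l are the steps from the entry m + i + f
  -- in the first row to the two entries below m in the first column.
  entryForms : Vec (Vec (Vec ℕ 5) 3) 3
  entryForms =
    --  i   f   k   l   m
    ( (0 ∷ 0 ∷ 0 ∷ 0 ∷ 1 ∷ [])
    ∷ (1 ∷ 1 ∷ 0 ∷ 0 ∷ 1 ∷ [])
    ∷ (1 ∷ 1 ∷ 2 ∷ 1 ∷ 1 ∷ []) ∷ [])
    ∷
    ( (1 ∷ 1 ∷ 1 ∷ 0 ∷ 1 ∷ [])
    ∷ (1 ∷ 0 ∷ 1 ∷ 1 ∷ 1 ∷ [])
    ∷ (0 ∷ 1 ∷ 0 ∷ 0 ∷ 1 ∷ []) ∷ [])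
    ∷
    ( (1 ∷ 1 ∷ 1 ∷ 1 ∷ 1 ∷ [])
    ∷ (0 ∷ 1 ∷ 1 ∷ 0 ∷ 1 ∷ [])
    ∷ (1 ∷ 0 ∷ 0 ∷ 0 ∷ 1 ∷ []) ∷ [])
    ∷ []

  sumForm : Vec ℕ 5
  sumForm = 2 ∷ 2 ∷ 2 ∷ 1 ∷ 3 ∷ []

  square : Vec ℕ 5 → Matrix
  square a = map (map (_· a)) entryForms

  entryForm : Fin 3 → Fin 3 → Vec ℕ 5
  entryForm r c = lookup (lookup entryForms r) c

  parameters : Matrix → Vec ℕ 5
  parameters M =
    M ⟦ 2F , 2F ⟧ ∸ M ⟦ 0F , 0F ⟧ ∷ M ⟦ 1F , 2F ⟧ ∸ M ⟦ 0F , 0F ⟧ ∷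
    M ⟦ 1F , 0F ⟧ ∸ M ⟦ 0F , 1F ⟧ ∷ M ⟦ 2F , 0F ⟧ ∸ M ⟦ 1F , 0F ⟧ ∷
    M ⟦ 0F , 0F ⟧ ∷ []

  -- Reflects `_·_` into solver syntax, so that a concrete entry form can be one side of a solver
  -- equation.
  formPolynomial : ∀ {m n} → Vec ℕ n → Vec (+-*-Solver.Polynomial m) n → +-*-Solver.Polynomial m
  formPolynomial []       []       = con 0 where open +-*-Solver
  formPolynomial (w ∷ ws) (x ∷ xs) = con w :* x :+ formPolynomial ws xs where open +-*-Solver

  form : ∀ {n} → Vec ℕ 5 → (i f k l m : +-*-Solver.Polynomial n) → +-*-Solver.Polynomial n
  form w i f k l m = formPolynomial w (i ∷ f ∷ k ∷ l ∷ m ∷ [])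

  parameters-square : ∀ a → parameters (square a) ≡ a
  parameters-square (i ∷ f ∷ k ∷ l ∷ m ∷ []) =
    cong₂ _∷_ (difference
      (solve 5 (λ i f k l m → form (entryForm 2F 2F) i f k l m := form (entryForm 0F 0F) i f k l m :+ i) refl i f k l m))
    (cong₂ _∷_ (difference
      (solve 5 (λ i f k l m → form (entryForm 1F 2F) i f k l m := form (entryForm 0F 0F) i f k l m :+ f) refl i f k l m))
    (cong₂ _∷_ (difference
      (solve 5 (λ i f k l m → form (entryForm 1F 0F) i f k l m := form (entryForm 0F 1F) i f k l m :+ k) refl i f k l m))
    (cong₂ _∷_ (difference
      (solve 5 (λ i f k l m → form (entryForm 2F 0F) i f k l m := form (entryForm 1F 0F) i f k l m :+ l) refl i f k l m))
    (cong (_∷ []) (solve 5 (λ i f k l m → form (entryForm 0F 0F) i f k l m := m) refl i f k l m)))))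
    where
    open +-*-Solver
    difference : ∀ {x y z} → x ≡ y + z → x ∸ y ≡ z
    difference {y = y} {z} refl = m+n∸m≡n y z

  ·-+ : ∀ {n} (u v a : Vec ℕ n) → Vec.zipWith _+_ u v · a ≡ u · a + v · a
  ·-+ []       []       []       = refl
  ·-+ (x ∷ u) (y ∷ v) (a ∷ as) = trans (cong ((x + y) * a +_) (·-+ u v as))
    (solve 5 (λ x y a s t → (x :+ y) :* a :+ (s :+ t) := (x :* a :+ s) :+ (y :* a :+ t)) refl x y a (u · as) (v · as))
    where open +-*-Solver

  0-· : ∀ {n} (a : Vec ℕ n) → Vec.replicate n 0 · a ≡ 0
  0-· []       = refl
  0-· (a ∷ as) = 0-· as

  sum-forms : ∀ {n k} (fs : Vec (Vec ℕ n) k) a →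
              Vec.sum (map (_· a) fs) ≡ Vec.foldr _ (Vec.zipWith _+_) (Vec.replicate n 0) fs · a
  sum-forms []       a = sym (0-· a)
  sum-forms (f ∷ fs) a = trans (cong (f · a +_) (sum-forms fs a)) (sym (·-+ f _ a))

  square-entry : ∀ a r c → square a ⟦ r , c ⟧ ≡ entryForm r c · a
  square-entry a r c = trans (cong (λ v → lookup v c) (lookup-map r (map (_· a)) entryForms))
                             (lookup-map c (_· a) (lookup entryForms r))

  leastForm : ∀ r c → Pointwise _≤_ (entryForm 0F 0F) (entryForm r c)
  leastForm = from-yes (Fin.all? λ r → Fin.all? λ c → Pointwise.decidable _≤?_ (entryForm 0F 0F) (entryForm r c))

  square-normal : ∀ {t a} → Solution sumForm (concat entryForms) t a → Normal t (square a)
  square-normal {t} {a} (solution pos total distinct) = normal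
    (rowsOrdered (columnsOrdered (leastFirst (semimagic⇒entrywise isSemimagic)
      (λ r c → subst (entryForm 0F 0F · a ≤_) (sym (square-entry a r c)) (·-mono (leastForm r c))))
      (increasing (entryForm 0F 1F) (entryForm 0F 2F))) (increasing (entryForm 1F 0F) (entryForm 2F 0F)))
      (increasing (entryForm 0F 1F) (entryForm 1F 0F))
    where
    increasing : ∀ f g {_ : True (Pointwise.decidable _≤?_ f g)} {_ : False (≡-dec _≟_ f g)} → f · a < g · a
    increasing f g {f≤g} {f≢g} =
      ≤∧≢⇒< (·-mono (toWitness f≤g)) (toWitnessFalse f≢g ∘ ·-cancel (toWitness f≤g) pos)

    least-positive : 0 < entryForm 0F 0F · a
    least-positive = last-positive pos
      where
      last-positive : ∀ {b} → All (0 <_) b → 0 < entryForm 0F 0F · b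
      last-positive (_ ∷ _ ∷ _ ∷ _ ∷ m>0 ∷ []) = ≤-trans m>0 (≤-trans (m≤m+n _ 0) (m≤m+n _ 0))

    entries : concat (square a) ≡ map (_· a) (concat entryForms)
    entries = sym (map-concat (_· a) entryForms)

    isSemimagic : IsSemimagic t (square a)
    isSemimagic = semimagic
      (All.concat⁺ (All.lookup⁻ λ r → All.lookup⁻ λ c → ≤-trans least-positive
        (subst (entryForm 0F 0F · a ≤_) (sym (square-entry a r c)) (·-mono (leastForm r c)))))
      (subst Unique (sym entries) distinct)
      (line (entryForms-row 0F) ∷ line (entryForms-row 1F) ∷ line (entryForms-row 2F) ∷ [])
      (line (entryForms-column 0F) ∷ line (entryForms-column 1F) ∷ line (entryForms-column 2F) ∷ [])
      where
      entryForms-row entryForms-column : Fin 3 → Vec (Vec ℕ 5) 3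
      entryForms-row = lookup entryForms
      entryForms-column = lookup (transpose entryForms)

      -- The entry forms along a row or column are closed vectors, so that they add up to `sumForm`
      -- is decided by evaluation.
      line : ∀ fs {_ : True (≡-dec _≟_ (Vec.foldr (λ _ → Vec ℕ 5) (Vec.zipWith _+_) (Vec.replicate 5 0) fs) sumForm)} →
             Vec.sum (map (_· a) (fs)) ≡ t
      line fs {eq} = trans (sum-forms fs a) (trans (cong (_· a) (toWitness eq)) total)

  square-value : ∀ i f k l m → square (i ∷ f ∷ k ∷ l ∷ m ∷ []) ≡
    (m ∷ m + f + i ∷ m + f + i + k + k + l ∷ []) ∷
    (m + f + i + k ∷ k + l + m + i ∷ m + f ∷ []) ∷
    (m + f + i + k + l ∷ k + m + f ∷ m + i ∷ []) ∷ []
  square-value i f k l m = entries-injective λ where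
      0F 0F → solve 5 (λ i f k l m → form (entryForm 0F 0F) i f k l m := m) refl i f k l m
      0F 1F → solve 5 (λ i f k l m → form (entryForm 0F 1F) i f k l m := m :+ f :+ i) refl i f k l m
      0F 2F → solve 5 (λ i f k l m → form (entryForm 0F 2F) i f k l m := m :+ f :+ i :+ k :+ k :+ l) refl i f k l m
      1F 0F → solve 5 (λ i f k l m → form (entryForm 1F 0F) i f k l m := m :+ f :+ i :+ k) refl i f k l m
      1F 1F → solve 5 (λ i f k l m → form (entryForm 1F 1F) i f k l m := k :+ l :+ m :+ i) refl i f k l m
      1F 2F → solve 5 (λ i f k l m → form (entryForm 1F 2F) i f k l m := m :+ f) refl i f k l m
      2F 0F → solve 5 (λ i f k l m → form (entryForm 2F 0F) i f k l m := m :+ f :+ i :+ k :+ l) refl i f k l m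
      2F 1F → solve 5 (λ i f k l m → form (entryForm 2F 1F) i f k l m := k :+ m :+ f) refl i f k l m
      2F 2F → solve 5 (λ i f k l m → form (entryForm 2F 2F) i f k l m := m :+ i) refl i f k l m
    where open +-*-Solver

  -- Two lines of a semimagic square that cross share an entry, which cancels in the equality of their sums.
  reconstruct : ∀ {t i f k l m b c e h} →
    let M = (m ∷ b ∷ c ∷ []) ∷ (b + k ∷ e ∷ m + f ∷ []) ∷ (b + k + l ∷ h ∷ m + i ∷ []) ∷ [] in
    Semimagic t M → square (i ∷ f ∷ k ∷ l ∷ m ∷ []) ≡ M
  reconstruct {i = i} {f} {k} {l} {m} {b} {c} {e} {h} s = trans (square-value i f k l m) (rewrite-entries b≡ c≡ e≡ h≡)
    where
    open +-*-Solver
    open Semimagic s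

    cancel : ∀ x {y z u v} → u ≡ x + y → u ≡ v → v ≡ x + z → y ≡ z
    cancel x p q r = +-cancelˡ-≡ x _ _ (trans (sym p) (trans q r))

    rewrite-entries : ∀ {b c e h} → b ≡ m + f + i → c ≡ b + k + k + l → e ≡ k + l + m + i → h ≡ k + m + f →
      (m ∷ m + f + i ∷ m + f + i + k + k + l ∷ []) ∷
      (m + f + i + k ∷ k + l + m + i ∷ m + f ∷ []) ∷
      (m + f + i + k + l ∷ k + m + f ∷ m + i ∷ []) ∷ [] ≡
      (m ∷ b ∷ c ∷ []) ∷ (b + k ∷ e ∷ m + f ∷ []) ∷ (b + k + l ∷ h ∷ m + i ∷ []) ∷ []
    rewrite-entries refl refl refl refl = refl

    b≡ : b ≡ m + f + i
    b≡ = cancel (m + c)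
      (solve 3 (λ m b c → m :+ (b :+ (c :+ con 0)) := m :+ c :+ b) refl m b c)
      (trans (rows 0F) (sym (columns 2F)))
      (solve 4 (λ i f m c → c :+ (m :+ f :+ (m :+ i :+ con 0)) := m :+ c :+ (m :+ f :+ i)) refl i f m c)

    h≡ : h ≡ k + m + f
    h≡ = cancel (b + e)
      (solve 3 (λ b e h → b :+ (e :+ (h :+ con 0)) := b :+ e :+ h) refl b e h)
      (trans (columns 1F) (sym (rows 1F)))
      (solve 5 (λ f k m b e → b :+ k :+ (e :+ (m :+ f :+ con 0)) := b :+ e :+ (k :+ m :+ f)) refl f k m b e)

    e≡ : e ≡ k + l + m + i
    e≡ = cancel (b + h)
      (solve 3 (λ b e h → b :+ (e :+ (h :+ con 0)) := b :+ h :+ e) refl b e h)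
      (trans (columns 1F) (sym (rows 2F)))
      (solve 6 (λ i k l m b h → b :+ k :+ l :+ (h :+ (m :+ i :+ con 0)) := b :+ h :+ (k :+ l :+ m :+ i)) refl i k l m b h)

    c≡ : c ≡ b + k + k + l
    c≡ = cancel (m + b)
      (solve 3 (λ m b c → m :+ (b :+ (c :+ con 0)) := m :+ b :+ c) refl m b c)
      (trans (rows 0F) (sym (columns 0F)))
      (solve 4 (λ k l m b → m :+ (b :+ k :+ (b :+ k :+ l :+ con 0)) := m :+ b :+ (b :+ k :+ k :+ l)) refl k l m b)

  -- The orders in `Normal` make the truncated differences exact; rewriting d as `b + (d ∸ b)`, and
  -- likewise the other entries, brings M into the shape that `reconstruct` treats.
  square-parameters : ∀ {t M} → Normal t M → square (parameters M) ≡ M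
  square-parameters {t} {M = (a ∷ b ∷ c ∷ []) ∷ (d ∷ e ∷ f ∷ []) ∷ (g ∷ h ∷ j ∷ []) ∷ []}
    (normal (rowsOrdered (columnsOrdered (leastFirst s least) _) d<g) b<d) =
    trans (reconstruct {b = b} (subst (Semimagic t) (sym eq) s)) eq
    where
    d≡ : b + (d ∸ b) ≡ d
    d≡ = m+[n∸m]≡n (<⇒≤ b<d)

    eq : (a ∷ b ∷ c ∷ []) ∷ (b + (d ∸ b) ∷ e ∷ a + (f ∸ a) ∷ []) ∷ (b + (d ∸ b) + (g ∸ d) ∷ h ∷ a + (j ∸ a) ∷ []) ∷ []
         ≡ (a ∷ b ∷ c ∷ []) ∷ (d ∷ e ∷ f ∷ []) ∷ (g ∷ h ∷ j ∷ []) ∷ []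
    eq = cong₂ (λ r s → (a ∷ b ∷ c ∷ []) ∷ r ∷ s ∷ [])
      (cong₂ (λ x y → x ∷ e ∷ y ∷ []) d≡ (m+[n∸m]≡n (least 1F 2F)))
      (cong₂ (λ x y → x ∷ h ∷ y ∷ [])
        (trans (cong (_+ (g ∸ d)) d≡) (m+[n∸m]≡n (<⇒≤ d<g)))
        (m+[n∸m]≡n (least 2F 2F)))

  parameters-positive : ∀ {t M} → Normal t M → All (0 <_) (parameters M)
  parameters-positive (normal (rowsOrdered (columnsOrdered (leastFirst s least) _) d<g) b<d) =
    m<n⇒0<n∸m (≤∧≢⇒< (least 2F 2F) (λ eq → case distinct eq of λ ())) ∷
    m<n⇒0<n∸m (≤∧≢⇒< (least 1F 2F) (λ eq → case distinct eq of λ ())) ∷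
    m<n⇒0<n∸m b<d ∷ m<n⇒0<n∸m d<g ∷ positive 0F 0F ∷ []
    where open Semimagic s

  normal-solution : ∀ {t M} → Normal t M → Solution sumForm (concat entryForms) t (parameters M)
  normal-solution {t} {M} n = solution (parameters-positive n)
    (trans (sym (sum-forms (lookup entryForms 0F) (parameters M)))
      (trans (cong (λ N → Vec.sum (lookup N 0F)) (square-parameters n)) (row₀ (IsSemimagic.rows semimagicM))))
    (subst Unique (trans (cong concat (sym (square-parameters n))) (sym (map-concat (_· parameters M) entryForms)))
      (IsSemimagic.distinct semimagicM))
    where
    semimagicM : IsSemimagic t M
    semimagicM = entrywise⇒semimagic
      (LeastFirst.isSemimagic (ColumnsOrdered.isLeastFirst (RowsOrdered.isColumnsOrdered (Normal.isRowsOrdered n))))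
    row₀ : ∀ {N : Matrix} → All (λ r → Vec.sum r ≡ t) N → Vec.sum (lookup N 0F) ≡ t
    row₀ (eq ∷ _) = eq

  count-squares : ∀ {t n} → Count (Solution sumForm (concat entryForms) t) n → Sₐ t ≡ 72 * n
  count-squares c = count-72 (count-image square
    (λ {a} {b} _ _ eq → trans (sym (parameters-square a)) (trans (cong parameters eq) (parameters-square b)))
    square-normal
    (λ {M} n → parameters M , normal-solution n , square-parameters n)
    c)

  -- Only the shape of the tree is supplied: weights and forms at each node are computed from the
  -- root, and the conditions of `leaf` and `void` are decided during type checking. `fore` selects
  -- the coordinate that the following cut compares with the first of the others.
  decomposition : Decomposition sumForm (concat entryForms)
  decomposition = split
        (fore 2F (split
          (fore 2F (fore 3F (split
            (fore 1F (fore 2F (split leaf leaf void)))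
            (fore 3F (split
              (fore 3F (fore 2F (split leaf leaf void)))
              leaf
              void))
            void)))
          (fore 2F (fore 3F (split
            (fore 1F (fore 2F (split
              (fore 3F (fore 2F (split leaf leaf void)))
              leaf
              void)))
            (fore 3F (split leaf leaf void))
            void)))
          void))
        (fore 2F (split
          (fore 2F (fore 3F (split
            (fore 1F (fore 2F (split leaf leaf void)))
            leaf
            void)))
          (fore 2F (split
            (fore 3F (split leaf leaf void))
            (fore 3F (split
              (fore 3F (fore 2F (split leaf leaf void)))
              (fore 2F (split leaf leaf void))
              -- This face is i = k + l, where no two entries coincide. The cut only serves to make
              -- the forms comparable, so its face contributes a four-dimensional cone.
              leaf))
            void))
          void))
        void

-- Multiplication of power series by polynomials, and division.

module PowerSeries where

  open import Data.Integer as ℤ using (ℤ; +_; -_)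
  import Data.Integer.Properties as ℤ
  open import Data.Integer.Solver using (module +-*-Solver)
  open import Data.List as List using (List; []; _∷_; _++_; replicate)
  open import Data.Nat using (ℕ; zero; suc; _+_; _<_; s≤s)
  open import Function using (_∘_)
  open import Relation.Binary.PropositionalEquality using (_≡_; _≗_; refl; sym; trans; cong; cong₂)

  infixl 6 _+ₚ_
  infixl 7 _*ₚ_ _⋆_

  _+ₚ_ : List ℤ → List ℤ → List ℤ
  []      +ₚ q       = q
  (a ∷ p) +ₚ []      = a ∷ p
  (a ∷ p) +ₚ (b ∷ q) = (a ℤ.+ b) ∷ (p +ₚ q)

  scale : ℤ → List ℤ → List ℤ
  scale a = List.map (a ℤ.*_)

  _*ₚ_ : List ℤ → List ℤ → List ℤ
  p *ₚ []      = []
  p *ₚ (a ∷ q) = scale a p +ₚ (+ 0 ∷ p *ₚ q)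

  delay : Series → Series
  delay F zero    = + 0
  delay F (suc n) = F n

  -- Recursion on the polynomial, in step with `_*ₚ_`, makes associativity an induction over
  -- coefficient lists.
  _⋆_ : Series → List ℤ → Series
  (F ⋆ [])      n = + 0
  (F ⋆ (a ∷ p)) n = a ℤ.* F n ℤ.+ delay (F ⋆ p) n

  delay-cong : ∀ {F G} → F ≗ G → delay F ≗ delay G
  delay-cong F≗G zero    = refl
  delay-cong F≗G (suc n) = F≗G n

  ⋆-cong : ∀ {F G} → F ≗ G → ∀ p → F ⋆ p ≗ G ⋆ p
  ⋆-cong F≗G []      n = refl
  ⋆-cong F≗G (a ∷ p) n = cong₂ ℤ._+_ (cong (a ℤ.*_) (F≗G n)) (delay-cong (⋆-cong F≗G p) n)

  ⋆-+ₚ : ∀ F p q n → (F ⋆ (p +ₚ q)) n ≡ (F ⋆ p) n ℤ.+ (F ⋆ q) n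
  ⋆-+ₚ F []      q       n = sym (ℤ.+-identityˡ _)
  ⋆-+ₚ F (a ∷ p) []      n = sym (ℤ.+-identityʳ _)
  ⋆-+ₚ F (a ∷ p) (b ∷ q) zero =
    solve 3 (λ a b x → (a :+ b) :* x :+ con (+ 0) := (a :* x :+ con (+ 0)) :+ (b :* x :+ con (+ 0))) refl a b (F 0)
    where open +-*-Solver
  ⋆-+ₚ F (a ∷ p) (b ∷ q) (suc n) = trans (cong (λ z → (a ℤ.+ b) ℤ.* F (suc n) ℤ.+ z) (⋆-+ₚ F p q n))
    (solve 5 (λ a b x y z → (a :+ b) :* x :+ (y :+ z) := (a :* x :+ y) :+ (b :* x :+ z)) refl a b (F (suc n)) ((F ⋆ p) n) ((F ⋆ q) n))
    where open +-*-Solver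

  ⋆-scale : ∀ F a p n → (F ⋆ scale a p) n ≡ a ℤ.* (F ⋆ p) n
  ⋆-scale F a []      n       = sym (ℤ.*-zeroʳ a)
  ⋆-scale F a (b ∷ p) zero    =
    solve 3 (λ a b x → a :* b :* x :+ con (+ 0) := a :* (b :* x :+ con (+ 0))) refl a b (F 0)
    where open +-*-Solver
  ⋆-scale F a (b ∷ p) (suc n) = trans (cong (λ z → a ℤ.* b ℤ.* F (suc n) ℤ.+ z) (⋆-scale F a p n))
    (solve 4 (λ a b x y → a :* b :* x :+ a :* y := a :* (b :* x :+ y)) refl a b (F (suc n)) ((F ⋆ p) n))
    where open +-*-Solver

  ⋆-0∷ : ∀ F p → F ⋆ (+ 0 ∷ p) ≗ delay (F ⋆ p)
  ⋆-0∷ F p n = trans (cong (ℤ._+ delay (F ⋆ p) n) (ℤ.*-zeroˡ (F n))) (ℤ.+-identityˡ _)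

  ⋆-assoc : ∀ F p q → (F ⋆ p) ⋆ q ≗ F ⋆ (p *ₚ q)
  ⋆-assoc F p []      n = refl
  ⋆-assoc F p (a ∷ q) n = sym (trans (⋆-+ₚ F (scale a p) (+ 0 ∷ p *ₚ q) n)
    (cong₂ ℤ._+_ (⋆-scale F a p n)
      (trans (⋆-0∷ F (p *ₚ q) n) (delay-cong (sym ∘ ⋆-assoc F p q) n))))

  ⋆-delay : ∀ F p → delay F ⋆ p ≗ delay (F ⋆ p)
  ⋆-delay F []      zero    = refl
  ⋆-delay F []      (suc n) = refl
  ⋆-delay F (a ∷ p) zero    = trans (ℤ.+-identityʳ _) (ℤ.*-zeroʳ a)
  ⋆-delay F (a ∷ p) (suc n) = cong (λ z → a ℤ.* F n ℤ.+ z) (⋆-delay F p n)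

  ⋆-plus : ∀ F G p n → ((λ k → F k ℤ.+ G k) ⋆ p) n ≡ (F ⋆ p) n ℤ.+ (G ⋆ p) n
  ⋆-plus F G []      n       = refl
  ⋆-plus F G (a ∷ p) zero    =
    solve 3 (λ a x y → a :* (x :+ y) :+ con (+ 0) := (a :* x :+ con (+ 0)) :+ (a :* y :+ con (+ 0))) refl a (F 0) (G 0)
    where open +-*-Solver
  ⋆-plus F G (a ∷ p) (suc n) = trans (cong (λ z → a ℤ.* (F (suc n) ℤ.+ G (suc n)) ℤ.+ z) (⋆-plus F G p n))
    (solve 5 (λ a x y u v → a :* (x :+ y) :+ (u :+ v) := (a :* x :+ u) :+ (a :* y :+ v)) refl
      a (F (suc n)) (G (suc n)) ((F ⋆ p) n) ((G ⋆ p) n))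
    where open +-*-Solver

  ⋆-∙ : ∀ c F p → (c ∙ F) ⋆ p ≗ c ∙ (F ⋆ p)
  ⋆-∙ c F []      n       = sym (ℤ.*-zeroʳ c)
  ⋆-∙ c F (a ∷ p) zero    =
    solve 3 (λ a c x → a :* (c :* x) :+ con (+ 0) := c :* (a :* x :+ con (+ 0))) refl a c (F 0)
    where open +-*-Solver
  ⋆-∙ c F (a ∷ p) (suc n) = trans (cong (λ z → a ℤ.* (c ℤ.* F (suc n)) ℤ.+ z) (⋆-∙ c F p n))
    (solve 4 (λ a c x y → a :* (c :* x) :+ c :* y := c :* (a :* x :+ y)) refl a c (F (suc n)) ((F ⋆ p) n))
    where open +-*-Solver

  ⊛-congˡ : ∀ {F G} H → F ≗ G → F ⊛ H ≗ G ⊛ H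
  ⊛-congˡ H F≗G zero    = cong (ℤ._* H 0) (F≗G 0)
  ⊛-congˡ H F≗G (suc n) = cong₂ ℤ._+_ (cong (ℤ._* H (suc n)) (F≗G 0)) (⊛-congˡ H (F≗G ∘ suc) n)

  ⊛-congʳ : ∀ F {G H} → G ≗ H → F ⊛ G ≗ F ⊛ H
  ⊛-congʳ F G≗H zero    = cong (F 0 ℤ.*_) (G≗H 0)
  ⊛-congʳ F G≗H (suc n) = cong₂ ℤ._+_ (cong (F 0 ℤ.*_) (G≗H (suc n))) (⊛-congʳ (F ∘ suc) G≗H n)

  -- `_⊛_` unfolds along its first factor but `_⋆_` along its second; this peels the Cauchy product
  -- from the other end to reconcile them.
  ⊛-last : ∀ F G n → (F ⊛ G) (suc n) ≡ G 0 ℤ.* F (suc n) ℤ.+ (F ⊛ (G ∘ suc)) n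
  ⊛-last F G zero    = solve 4 (λ x y u v → x :* v :+ y :* u := u :* y :+ x :* v) refl (F 0) (F 1) (G 0) (G 1)
    where open +-*-Solver
  ⊛-last F G (suc n) = trans (cong (λ z → F 0 ℤ.* G (suc (suc n)) ℤ.+ z) (⊛-last (F ∘ suc) G n))
    (solve 3 (λ x y z → x :+ (y :+ z) := y :+ (x :+ z)) refl
      (F 0 ℤ.* G (suc (suc n))) (G 0 ℤ.* F (suc (suc n))) (((F ∘ suc) ⊛ (G ∘ suc)) n))
    where open +-*-Solver

  ⊛-fromCoefficients : ∀ F p → F ⊛ fromCoefficients p ≗ F ⋆ p
  ⊛-fromCoefficients F []      zero    = ℤ.*-zeroʳ (F 0)
  ⊛-fromCoefficients F []      (suc n) =
    trans (cong₂ ℤ._+_ (ℤ.*-zeroʳ (F 0)) (⊛-fromCoefficients (F ∘ suc) [] n)) refl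
  ⊛-fromCoefficients F (a ∷ p) zero    = trans (ℤ.*-comm (F 0) a) (sym (ℤ.+-identityʳ _))
  ⊛-fromCoefficients F (a ∷ p) (suc n) = trans (⊛-last F (fromCoefficients (a ∷ p)) n)
    (cong (λ z → a ℤ.* F (suc n) ℤ.+ z) (⊛-fromCoefficients F p n))

  one : Series
  one = fromCoefficients (+ 1 ∷ [])

  one-⋆ : ∀ p → one ⋆ p ≗ fromCoefficients p
  one-⋆ []      n             = refl
  one-⋆ (a ∷ p) zero          = trans (ℤ.+-identityʳ _) (ℤ.*-identityʳ a)
  one-⋆ (a ∷ p) (suc zero)    = trans (cong₂ ℤ._+_ (ℤ.*-zeroʳ a) (one-⋆ p 0)) (ℤ.+-identityˡ _)
  one-⋆ (a ∷ p) (suc (suc n)) = trans (cong₂ ℤ._+_ (ℤ.*-zeroʳ a) (one-⋆ p (suc n))) (ℤ.+-identityˡ _)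

  fromCoefficients-*ₚ : ∀ {F G p q} → F ≗ fromCoefficients p → G ≗ fromCoefficients q → F ⊛ G ≗ fromCoefficients (p *ₚ q)
  fromCoefficients-*ₚ {F} {G} {p} {q} F≗ G≗ n =
    trans (⊛-congʳ F G≗ n)
    (trans (⊛-fromCoefficients F q n)
    (trans (⋆-cong (λ k → trans (F≗ k) (sym (one-⋆ p k))) q n)
    (trans (⋆-assoc one p q n) (one-⋆ (p *ₚ q) n))))

  monomial : ℕ → List ℤ
  monomial k = replicate k (+ 0) ++ + 1 ∷ []

  oneMinus : ℕ → List ℤ
  oneMinus k = (+ 1 ∷ []) +ₚ scale (- + 1) (monomial k)

  shift : ℕ → Series → Series
  shift zero    F = F
  shift (suc k) F = delay (shift k F)

  shift-cong : ∀ k {F G} → F ≗ G → shift k F ≗ shift k G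
  shift-cong zero    F≗G = F≗G
  shift-cong (suc k) F≗G = delay-cong (shift-cong k F≗G)

  ⋆-shift : ∀ k F p → shift k F ⋆ p ≗ shift k (F ⋆ p)
  ⋆-shift zero    F p n = refl
  ⋆-shift (suc k) F p n = trans (⋆-delay (shift k F) p n) (delay-cong (⋆-shift k F p) n)

  shift-+ : ∀ k n F → shift k F (k + n) ≡ F n
  shift-+ zero    n F = refl
  shift-+ (suc k) n F = shift-+ k n F

  shift-< : ∀ {k n} F → n < k → shift k F n ≡ + 0
  shift-< {suc k} {zero}  F _         = refl
  shift-< {suc k} {suc n} F (s≤s n<k) = shift-< F n<k

  shift-fromCoefficients : ∀ k p → shift k (fromCoefficients p) ≗ fromCoefficients (replicate k (+ 0) ++ p)
  shift-fromCoefficients zero    p n       = refl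
  shift-fromCoefficients (suc k) p zero    = refl
  shift-fromCoefficients (suc k) p (suc n) = shift-fromCoefficients k p n

  ⋆-replicate : ∀ k F p → F ⋆ (replicate k (+ 0) ++ p) ≗ shift k (F ⋆ p)
  ⋆-replicate zero    F p n = refl
  ⋆-replicate (suc k) F p n = trans (⋆-0∷ F (replicate k (+ 0) ++ p) n) (delay-cong (⋆-replicate k F p) n)

  ⋆-1 : ∀ F → F ⋆ (+ 1 ∷ []) ≗ F
  ⋆-1 F zero    = trans (ℤ.+-identityʳ _) (ℤ.*-identityˡ _)
  ⋆-1 F (suc n) = trans (ℤ.+-identityʳ _) (ℤ.*-identityˡ _)

  ⋆-oneMinus : ∀ F k n → (F ⋆ oneMinus k) n ≡ F n ℤ.- shift k F n
  ⋆-oneMinus F k n = trans (⋆-+ₚ F (+ 1 ∷ []) (scale (- + 1) (monomial k)) n)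
    (cong₂ ℤ._+_ (⋆-1 F n)
      (trans (⋆-scale F (- + 1) (monomial k) n)
      (trans (ℤ.-1*i≡-i _) (cong -_ (trans (⋆-replicate k F (+ 1 ∷ []) n) (shift-cong k (⋆-1 F) n))))))

  monomial-x^ : ∀ k → x^ k ≗ fromCoefficients (monomial k)
  monomial-x^ zero    zero    = refl
  monomial-x^ zero    (suc n) = refl
  monomial-x^ (suc k) zero    = refl
  monomial-x^ (suc k) (suc n) = monomial-x^ k n

  oneMinus-1-x^ : ∀ k → 1-x^ k ≗ fromCoefficients (oneMinus k)
  oneMinus-1-x^ k n = sym (trans (sym (one-⋆ (oneMinus k) n)) (trans (⋆-oneMinus one k n)
    (cong₂ ℤ._-_ (sym (monomial-x^ 0 n))
      (trans (shift-fromCoefficients k (+ 1 ∷ []) n) (sym (monomial-x^ k n))))))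

  ⊘-cong : ∀ {P Q} D → P ≗ Q → P ⊘ D ≗ Q ⊘ D
  ⊘-cong D P≗Q zero    = P≗Q 0
  ⊘-cong D P≗Q (suc n) = ⊘-cong D (λ k → cong₂ ℤ._-_ (P≗Q (suc k)) (cong (ℤ._* D (suc k)) (P≗Q 0))) n

  ⊛-⊘ : ∀ F D → D 0 ≡ + 1 → (F ⊛ D) ⊘ D ≗ F
  ⊛-⊘ F D D₀ zero    = trans (cong (F 0 ℤ.*_) D₀) (ℤ.*-identityʳ _)
  ⊛-⊘ F D D₀ (suc n) = trans
    (⊘-cong D (λ k → trans (cong (λ c → F 0 ℤ.* D (suc k) ℤ.+ ((F ∘ suc) ⊛ D) k ℤ.- F 0 ℤ.* c ℤ.* D (suc k)) D₀)
        (solve 3 (λ x d y → x :* d :+ y :- x :* con (+ 1) :* d := y) refl (F 0) (D (suc k)) (((F ∘ suc) ⊛ D) k))) n)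
    (⊛-⊘ (F ∘ suc) D D₀ n)
    where open +-*-Solver

  product-coefficients : ∀ ks {F p} → F ≗ fromCoefficients p →
    List.foldl (λ G k → G ⊛ (1-x^ k)) F ks ≗ fromCoefficients (List.foldl (λ q k → q *ₚ oneMinus k) p ks)
  product-coefficients []       F≗ = F≗
  product-coefficients (k ∷ ks) {F} {p} F≗ = product-coefficients ks
    (fromCoefficients-*ₚ {F} {1-x^ k} {p} {oneMinus k} F≗ (oneMinus-1-x^ k))

  -- Opaque, since conversion checking would otherwise expand products with this polynomial.
  opaque
    denominatorₚ : List ℤ
    denominatorₚ = List.foldl (λ q k → q *ₚ oneMinus k) (oneMinus 3) (3 ∷ 4 ∷ 5 ∷ 6 ∷ 7 ∷ 8 ∷ [])

    denominator-coefficients : denominator ≗ fromCoefficients denominatorₚ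
    denominator-coefficients = product-coefficients (3 ∷ 4 ∷ 5 ∷ 6 ∷ 7 ∷ 8 ∷ []) {1-x^ 3} {oneMinus 3} (oneMinus-1-x^ 3)

  -- Division undoes multiplication by a series with constant term 1. In particular, two series with
  -- the same product with the denominator are equal.
  by-denominator : ∀ {F G} → F ⋆ denominatorₚ ≗ G → F ≗ G ⊘ denominator
  by-denominator {F} {G} eq n = trans (sym (⊛-⊘ F denominator denominator₀ n))
    (⊘-cong denominator (λ k → trans (⊛-congʳ F denominator-coefficients k)
      (trans (⊛-fromCoefficients F denominatorₚ k) (eq k))) n)

-- The generating function as a sum over the cones.

module GeneratingFunction where

  open import Data.Integer as ℤ using (ℤ; +_; -_)
  import Data.Integer.Properties as ℤ
  open import Data.Integer.Solver using (module +-*-Solver)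
  open import Data.List using (List; []; _∷_; _++_; length; replicate)
  open import Data.List.Properties using () renaming (≡-dec to List-≡-dec)
  import Data.List.Relation.Unary.All as ListAll
  open import Data.Nat using (ℕ; zero; suc; _+_; _*_; _∸_; _<_; _<?_)
  open import Data.Nat.Properties
  open import Data.Product using (_,_)
  open import Data.Vec as Vec using (Vec; []; _∷_)
  open import Data.Vec.Relation.Unary.All using (All; []; _∷_)
  open import Relation.Binary.PropositionalEquality
    using (_≡_; _≗_; refl; sym; trans; cong; cong₂; subst; module ≡-Reasoning)
  open import Relation.Nullary using (yes; no)
  open import Relation.Nullary.Decidable using (from-yes)
  open Cones
  open NormalForm
  open PowerSeries

  denumerantSeries : ∀ {n} → Vec ℕ n → Series
  denumerantSeries w t = + denumerant w t

  denumerantSeries-[] : denumerantSeries [] ≗ one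
  denumerantSeries-[] zero    = refl
  denumerantSeries-[] (suc t) = refl

  -- `denumerant-step` as an identity of series: (1 - x^w) F = x^w G. It covers the coefficients
  -- from w on; the earlier ones vanish by `denumerant-below`.
  denumerantSeries-∷ : ∀ {n w} {ws : Vec ℕ n} → All (0 <_) (w ∷ ws) →
                       denumerantSeries (w ∷ ws) ⋆ oneMinus w ≗ shift w (denumerantSeries ws)
  denumerantSeries-∷ {w = w} {ws} w>0 t with t <? w
  ... | yes t<w = trans (⋆-oneMinus (denumerantSeries (w ∷ ws)) w t)
    (trans (cong₂ ℤ._-_ (cong +_ (denumerant-below w>0 t<w)) (shift-< (denumerantSeries (w ∷ ws)) t<w))
           (sym (shift-< (denumerantSeries ws) t<w)))
  ... | no t≮w = subst (λ t → (denumerantSeries (w ∷ ws) ⋆ oneMinus w) t ≡ shift w (denumerantSeries ws) t)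
    (m+[n∸m]≡n (≮⇒≥ t≮w)) (above (t ∸ w))
    where
    above : ∀ s → (denumerantSeries (w ∷ ws) ⋆ oneMinus w) (w + s) ≡ shift w (denumerantSeries ws) (w + s)
    above s = trans (⋆-oneMinus (denumerantSeries (w ∷ ws)) w (w + s))
      (trans (cong₂ ℤ._-_ (cong +_ (denumerant-step w>0 s)) (shift-+ w s (denumerantSeries (w ∷ ws))))
      (trans (solve 2 (λ x y → x :+ y :- y := x) refl (+ denumerant ws s) (+ denumerant (w ∷ ws) s))
        (sym (shift-+ w s (denumerantSeries ws)))))
      where open +-*-Solver

  weightDenominator : ∀ {n} → Vec ℕ n → List ℤ
  weightDenominator []       = + 1 ∷ []
  weightDenominator (w ∷ ws) = oneMinus w *ₚ weightDenominator ws

  denumerantSeries-denominator : ∀ {n} {w : Vec ℕ n} → All (0 <_) w →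
                                 denumerantSeries w ⋆ weightDenominator w ≗ shift (Vec.sum w) one
  denumerantSeries-denominator {w = []}     _           n = trans (⋆-1 (denumerantSeries []) n) (denumerantSeries-[] n)
  denumerantSeries-denominator {w = w ∷ ws} w>0@(_ ∷ ws>0) n = begin
    (F ⋆ (oneMinus w *ₚ D)) n              ≡⟨ ⋆-assoc F (oneMinus w) D n ⟨
    ((F ⋆ oneMinus w) ⋆ D) n               ≡⟨ ⋆-cong (denumerantSeries-∷ w>0) D n ⟩
    (shift w (denumerantSeries ws) ⋆ D) n  ≡⟨ ⋆-shift w (denumerantSeries ws) D n ⟩
    shift w (denumerantSeries ws ⋆ D) n    ≡⟨ shift-cong w (denumerantSeries-denominator ws>0) n ⟩
    shift w (shift (Vec.sum ws) one) n     ≡⟨ shift-∘ w (Vec.sum ws) n ⟩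
    shift (w + Vec.sum ws) one n           ∎
    where
    open ≡-Reasoning
    F = denumerantSeries (w ∷ ws)
    D = weightDenominator ws
    shift-∘ : ∀ j k → shift j (shift k one) ≗ shift (j + k) one
    shift-∘ zero    k n = refl
    shift-∘ (suc j) k n = delay-cong (shift-∘ j k) n

  -- The first n coefficients of p / q, for q with constant term 1.
  quotient : ℕ → List ℤ → List ℤ → List ℤ
  quotient (suc n) (a ∷ p) q@(_ ∷ q′) = a ∷ quotient n (p +ₚ scale (- a) q′) q
  quotient _       _       _          = []

  fromCoefficients-+ₚ : ∀ p q n → fromCoefficients (p +ₚ q) n ≡ fromCoefficients p n ℤ.+ fromCoefficients q n
  fromCoefficients-+ₚ []      q       n       = sym (ℤ.+-identityˡ _)
  fromCoefficients-+ₚ (a ∷ p) []      n       = sym (ℤ.+-identityʳ _)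
  fromCoefficients-+ₚ (a ∷ p) (b ∷ q) zero    = refl
  fromCoefficients-+ₚ (a ∷ p) (b ∷ q) (suc n) = fromCoefficients-+ₚ p q n

  ⋆-0 : ∀ p n → ((λ _ → + 0) ⋆ p) n ≡ + 0
  ⋆-0 []      n       = refl
  ⋆-0 (a ∷ p) zero    = trans (ℤ.+-identityʳ _) (ℤ.*-zeroʳ a)
  ⋆-0 (a ∷ p) (suc n) = cong₂ ℤ._+_ (ℤ.*-zeroʳ a) (⋆-0 p n)

  -- d is a common multiple of the weightDenominators that occur.
  module _ (d : List ℤ) where

    -- An exact quotient of `d` by a polynomial of degree Σ w has `length d ∸ Vec.sum w`
    -- coefficients. That the division is exact is certified by multiplying back, in `Divides`.
    cofactor : ∀ {n} → Vec ℕ n → List ℤ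
    cofactor w = quotient (length d ∸ Vec.sum w) d (weightDenominator w)

    numerator : ∀ {n} → Vec ℕ n → List ℤ
    numerator w = replicate (Vec.sum w) (+ 0) ++ cofactor w

    denumerantSeries-⋆ : ∀ {n} {w : Vec ℕ n} → All (0 <_) w → weightDenominator w *ₚ cofactor w ≡ d →
                         denumerantSeries w ⋆ d ≗ fromCoefficients (numerator w)
    denumerantSeries-⋆ {w = w} w>0 eq n = begin
      (F ⋆ d) n                                            ≡⟨ cong (λ p → (F ⋆ p) n) eq ⟨
      (F ⋆ (weightDenominator w *ₚ cofactor w)) n          ≡⟨ ⋆-assoc F (weightDenominator w) (cofactor w) n ⟨
      ((F ⋆ weightDenominator w) ⋆ cofactor w) n
        ≡⟨ ⋆-cong (denumerantSeries-denominator w>0) (cofactor w) n ⟩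
      (shift (Vec.sum w) one ⋆ cofactor w) n               ≡⟨ ⋆-shift (Vec.sum w) one (cofactor w) n ⟩
      shift (Vec.sum w) (one ⋆ cofactor w) n               ≡⟨ shift-cong (Vec.sum w) (one-⋆ (cofactor w)) n ⟩
      shift (Vec.sum w) (fromCoefficients (cofactor w)) n
        ≡⟨ shift-fromCoefficients (Vec.sum w) (cofactor w) n ⟩
      fromCoefficients (numerator w) n                     ∎
      where
      open ≡-Reasoning
      F = denumerantSeries w

    numerators : List Weights → List ℤ
    numerators []                  = []
    numerators ((_ , w , _) ∷ ws) = numerator w +ₚ numerators ws

    Divides : Weights → Set
    Divides (_ , w , _) = weightDenominator w *ₚ cofactor w ≡ d

    solutions-⋆ : ∀ {ws} → ListAll.All Divides ws → (λ t → + solutions ws t) ⋆ d ≗ fromCoefficients (numerators ws)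
    solutions-⋆ {[]} ListAll.[] n = ⋆-0 d n
    solutions-⋆ {(_ , w , w>0) ∷ ws} (eq ListAll.∷ eqs) n =
      trans (⋆-cong (λ t → ℤ.pos-+ (denumerant w t) (solutions ws t)) d n)
      (trans (⋆-plus (denumerantSeries w) (λ t → + solutions ws t) d n)
      (trans (cong₂ ℤ._+_ (denumerantSeries-⋆ w>0 eq n) (solutions-⋆ eqs n))
      (sym (fromCoefficients-+ₚ (numerator w) (numerators ws) n))))

  -- The coefficients of A, which are local to its definition.
  numeratorₚ : List ℤ
  numeratorₚ =
    + 1 ∷ + 2 ∷ + 4 ∷ + 6 ∷ + 7 ∷ + 9 ∷ + 7 ∷ + 7 ∷
    - + 3 ∷ + 1 ∷ - + 16 ∷ - + 9 ∷ - + 22 ∷ - + 13 ∷ - + 23 ∷ + 1 ∷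
    - + 8 ∷ + 11 ∷ + 0 ∷ + 15 ∷ + 5 ∷ + 18 ∷ []

  opaque
    unfolding denominatorₚ

    leaves-divide : ListAll.All (Divides denominatorₚ) (leaves decomposition)
    leaves-divide = from-yes (ListAll.all?
      (λ (_ , w , _) → List-≡-dec ℤ._≟_ (weightDenominator w *ₚ cofactor denominatorₚ w) denominatorₚ) (leaves decomposition))

    -- Lists are compared literally, including trailing zeros. This works because each summand is
    -- padded to length 37, which is 15 plus the 22 coefficients of `A`.
    leaves-numerators : numerators denominatorₚ (leaves decomposition) ≡ replicate 15 (+ 0) ++ numeratorₚ
    leaves-numerators = from-yes (List-≡-dec ℤ._≟_
      (numerators denominatorₚ (leaves decomposition)) (replicate 15 (+ 0) ++ numeratorₚ))

  Sₐ-solutions : ∀ t → Sₐ t ≡ 72 * solutions (leaves decomposition) t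
  Sₐ-solutions t = count-squares (count-leaves decomposition t)

  numerator-coefficients : x^ 15 ⊛ A ≗ fromCoefficients (replicate 15 (+ 0) ++ numeratorₚ)
  numerator-coefficients n = begin
    (x^ 15 ⊛ A) n                                           ≡⟨ ⊛-fromCoefficients (x^ 15) numeratorₚ n ⟩
    (x^ 15 ⋆ numeratorₚ) n
      ≡⟨ ⋆-cong (λ k → trans (monomial-x^ 15 k) (sym (shift-fromCoefficients 15 (+ 1 ∷ []) k))) numeratorₚ n ⟩
    (shift 15 one ⋆ numeratorₚ) n                           ≡⟨ ⋆-shift 15 one numeratorₚ n ⟩
    shift 15 (one ⋆ numeratorₚ) n                           ≡⟨ shift-cong 15 (one-⋆ numeratorₚ) n ⟩
    shift 15 (fromCoefficients numeratorₚ) n                ≡⟨ shift-fromCoefficients 15 numeratorₚ n ⟩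
    fromCoefficients (replicate 15 (+ 0) ++ numeratorₚ) n   ∎
    where open ≡-Reasoning

  generatingSeries-⋆ : generatingSeries ⋆ denominatorₚ ≗ + 72 ∙ (x^ 15 ⊛ A)
  generatingSeries-⋆ n = begin
    (generatingSeries ⋆ denominatorₚ) n           ≡⟨ ⋆-cong series denominatorₚ n ⟩
    ((+ 72 ∙ F) ⋆ denominatorₚ) n                 ≡⟨ ⋆-∙ (+ 72) F denominatorₚ n ⟩
    + 72 ℤ.* (F ⋆ denominatorₚ) n                 ≡⟨ cong (+ 72 ℤ.*_) (begin
      (F ⋆ denominatorₚ) n
        ≡⟨ solutions-⋆ denominatorₚ leaves-divide n ⟩
      fromCoefficients (numerators denominatorₚ (leaves decomposition)) n
        ≡⟨ cong (λ p → fromCoefficients p n) leaves-numerators ⟩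
      fromCoefficients (replicate 15 (+ 0) ++ numeratorₚ) n             ≡⟨ numerator-coefficients n ⟨
      (x^ 15 ⊛ A) n                                                     ∎) ⟩
    (+ 72 ∙ (x^ 15 ⊛ A)) n                        ∎
    where
    open ≡-Reasoning
    F : Series
    F t = + solutions (leaves decomposition) t

    series : generatingSeries ≗ + 72 ∙ F
    -- The series is 0 at 0 by definition, and `Sₐ 0` evaluates to 0 as well because the range of
    -- entries is empty.
    series zero    = trans (cong +_ (Sₐ-solutions 0)) (ℤ.pos-* 72 (solutions (leaves decomposition) 0))
    series (suc t) = trans (cong +_ (Sₐ-solutions (suc t))) (ℤ.pos-* 72 (solutions (leaves decomposition) (suc t)))

  generatingSeries-quotient : generatingSeries ≗ (+ 72 ∙ (x^ 15 ⊛ A)) ⊘ denominator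
  generatingSeries-quotient = by-denominator generatingSeries-⋆

-- Linear recurrences for quasipolynomials.

module QuasiPolynomials where

  open import Data.Integer as ℤ using (ℤ; +_; -_)
  import Data.Integer.Properties as ℤ
  open import Data.Integer.Solver using (module +-*-Solver)
  open import Data.List using (List; []; _∷_; length)
  import Data.List.Relation.Unary.All as ListAll
  open import Data.Nat using (ℕ; zero; suc; _+_; _*_; _∸_; _≤_; _<_; s≤s; _/_; _%_; NonZero)
  open import Data.Nat.DivMod
  open import Data.Nat.Properties
  open import Relation.Binary.PropositionalEquality
    using (_≡_; refl; sym; trans; cong; cong₂; subst; module ≡-Reasoning)
  open PowerSeries

  evaluateℤ : List ℤ → ℤ → ℤ
  evaluateℤ []      x = + 0
  evaluateℤ (a ∷ p) x = a ℤ.+ x ℤ.* evaluateℤ p x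

  evaluateℤ-+ₚ : ∀ p q x → evaluateℤ (p +ₚ q) x ≡ evaluateℤ p x ℤ.+ evaluateℤ q x
  evaluateℤ-+ₚ []      q       x = sym (ℤ.+-identityˡ _)
  evaluateℤ-+ₚ (a ∷ p) []      x = sym (ℤ.+-identityʳ _)
  evaluateℤ-+ₚ (a ∷ p) (b ∷ q) x = trans (cong (λ z → a ℤ.+ b ℤ.+ x ℤ.* z) (evaluateℤ-+ₚ p q x))
    (solve 5 (λ a b x y z → a :+ b :+ x :* (y :+ z) := (a :+ x :* y) :+ (b :+ x :* z)) refl a b x (evaluateℤ p x) (evaluateℤ q x))
    where open +-*-Solver

  evaluateℤ-scale : ∀ c p x → evaluateℤ (scale c p) x ≡ c ℤ.* evaluateℤ p x
  evaluateℤ-scale c []      x = sym (ℤ.*-zeroʳ c)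
  evaluateℤ-scale c (a ∷ p) x = trans (cong (λ z → c ℤ.* a ℤ.+ x ℤ.* z) (evaluateℤ-scale c p x))
    (solve 4 (λ c a x y → c :* a :+ x :* (c :* y) := c :* (a :+ x :* y)) refl c a x (evaluateℤ p x))
    where open +-*-Solver

  -- The coefficients of p (x - 1).
  translate : List ℤ → List ℤ
  translate []      = []
  translate (a ∷ p) = (a ∷ translate p) +ₚ scale (- + 1) (translate p)

  evaluateℤ-translate : ∀ p x → evaluateℤ (translate p) (+ 1 ℤ.+ x) ≡ evaluateℤ p x
  evaluateℤ-translate []      x = refl
  evaluateℤ-translate (a ∷ p) x = trans (evaluateℤ-+ₚ (a ∷ translate p) (scale (- + 1) (translate p)) (+ 1 ℤ.+ x))
    (trans (cong₂ (λ y z → a ℤ.+ (+ 1 ℤ.+ x) ℤ.* y ℤ.+ z) (evaluateℤ-translate p x)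
      (trans (evaluateℤ-scale (- + 1) (translate p) (+ 1 ℤ.+ x)) (cong (λ z → - + 1 ℤ.* z) (evaluateℤ-translate p x))))
    (solve 3 (λ a x y → a :+ (con (+ 1) :+ x) :* y :+ con (- + 1) :* y := a :+ x :* y) refl a x (evaluateℤ p x)))
    where open +-*-Solver

  -- The value at 0 is 0, not evaluateℤ (c 0) 0, to match generatingSeries.
  quasi : (ℕ → List ℤ) → Series
  quasi c zero      = + 0
  quasi c n@(suc _) = evaluateℤ (c n) (+ n)

  Periodic : ∀ {A : Set} → ℕ → (ℕ → A) → Set
  Periodic m c = ∀ n → c (m + n) ≡ c n

  periodic-* : ∀ {A : Set} m (c : ℕ → A) → Periodic m c → ∀ q n → c (q * m + n) ≡ c n
  periodic-* m c per zero    n = refl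
  periodic-* m c per (suc q) n =
    trans (cong c (+-assoc m (q * m) n)) (trans (per (q * m + n)) (periodic-* m c per q n))

  -- (quasi c ⋆ d) n is a polynomial in n on each residue class; combination c d r gives its
  -- coefficients on the class of r, as long as r ≥ length d keeps all arguments positive.
  combination : (ℕ → List ℤ) → List ℤ → ℕ → List ℤ
  combination c (a ∷ d) r@(suc s) = scale a (c r) +ₚ translate (combination c d s)
  combination c _       _         = []

  -- Each step along `d` lowers the argument by one, and `translate` rewrites the resulting
  -- polynomial in n - 1 as a polynomial in n. Its coefficients depend on the residue only, so
  -- finitely many classes decide the recurrence.
  quasi-⋆ : ∀ {m} c → Periodic m c → ∀ q d r → length d ≤ r →
            (quasi c ⋆ d) (q * m + r) ≡ evaluateℤ (combination c d r) (+ (q * m + r))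
  quasi-⋆     c per q []      r       _         = refl
  quasi-⋆ {m} c per q (a ∷ d) (suc s) (s≤s d≤s) rewrite +-suc (q * m) s = begin
    a ℤ.* evaluateℤ (c (suc n)) (+ suc n) ℤ.+ (quasi c ⋆ d) n
      ≡⟨ cong₂ (λ p z → a ℤ.* evaluateℤ p (+ suc n) ℤ.+ z)
           (trans (cong c (sym (+-suc (q * m) s))) (periodic-* m c per q (suc s))) (quasi-⋆ c per q d s d≤s) ⟩
    a ℤ.* evaluateℤ (c (suc s)) (+ suc n) ℤ.+ evaluateℤ (combination c d s) (+ n)
      ≡⟨ cong₂ ℤ._+_ (evaluateℤ-scale a (c (suc s)) (+ suc n)) (evaluateℤ-translate (combination c d s) (+ n)) ⟨
    evaluateℤ (scale a (c (suc s))) (+ suc n) ℤ.+ evaluateℤ (translate (combination c d s)) (+ suc n)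
      ≡⟨ evaluateℤ-+ₚ (scale a (c (suc s))) (translate (combination c d s)) (+ suc n) ⟨
    evaluateℤ (scale a (c (suc s)) +ₚ translate (combination c d s)) (+ suc n) ∎
    where
    open ≡-Reasoning
    n = q * m + s

  evaluateℤ-zero : ∀ {p} → ListAll.All (_≡ + 0) p → ∀ x → evaluateℤ p x ≡ + 0
  evaluateℤ-zero ListAll.[]           x = refl
  evaluateℤ-zero (refl ListAll.∷ p≡0) x = trans (ℤ.+-identityˡ _)
    (trans (cong (x ℤ.*_) (evaluateℤ-zero p≡0 x)) (ℤ.*-zeroʳ x))

  Annihilates : ℕ → (ℕ → List ℤ) → List ℤ → Set
  Annihilates m c d = ∀ {r} → r < m → ListAll.All (_≡ + 0) (combination c d (length d + r))

  quasi-annihilated : ∀ {m} .{{_ : NonZero m}} c d → Periodic m c → Annihilates m c d →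
                      ∀ n → length d ≤ n → (quasi c ⋆ d) n ≡ + 0
  quasi-annihilated {m} c d per annihilates n d≤n = subst (λ n → (quasi c ⋆ d) n ≡ + 0) n≡
    (trans (quasi-⋆ c per q d (length d + r) (m≤m+n (length d) r)) (evaluateℤ-zero (annihilates (m%n<n (n ∸ length d) m)) _))
    where
    -- The division is applied to `n ∸ length d`, so that the representative `length d + r` is large
    -- enough to keep the recurrence away from index 0.
    q = (n ∸ length d) / m
    r = (n ∸ length d) % m
    n≡ : q * m + (length d + r) ≡ n
    n≡ = begin
      q * m + (length d + r) ≡⟨ +-assoc (q * m) (length d) r ⟨
      q * m + length d + r   ≡⟨ cong (_+ r) (+-comm (q * m) (length d)) ⟩
      length d + q * m + r   ≡⟨ +-assoc (length d) (q * m) r ⟩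
      length d + (q * m + r) ≡⟨ cong (λ z → length d + z) (+-comm (q * m) r) ⟩
      length d + (r + q * m) ≡⟨ cong (λ z → length d + z) (m≡m%n+[m/n]*n (n ∸ length d) m) ⟨
      length d + (n ∸ length d) ≡⟨ m+[n∸m]≡n d≤n ⟩
      n ∎
      where open ≡-Reasoning

-- The stated constituents satisfy the recurrence of the counting function.

module Constituents where

  open import Data.Bool using (if_then_else_)
  import Data.Fin.Properties as Fin
  open import Data.Integer as ℤ using (ℤ; +_; -_)
  import Data.Integer.Properties as ℤ
  open import Data.Integer.Solver using (module +-*-Solver)
  open import Data.List using (List; []; _∷_; _++_; length; replicate)
  import Data.List.Relation.Unary.All as ListAll
  open import Data.Nat using (ℕ; zero; suc; _+_; _*_; _∸_; _≤_; _<_; s≤s; _/_; _%_; NonZero)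
  open import Data.Nat.DivMod
  open import Data.Nat.Divisibility using (divides)
  open import Data.Nat.Properties
  open import Data.Product using (_,_)
  open import Data.Rational using (ℚ; ↥_; ↧ₙ_)
  open import Data.Sum using ([_,_]′)
  open import Data.Vec using (Vec; []; _∷_; lookup)
  open import Relation.Binary.PropositionalEquality
    using (_≡_; _≗_; refl; sym; trans; cong; cong₂; module ≡-Reasoning)
  open import Relation.Nullary.Decidable using (does; from-yes)
  open import Data.List.Membership.DecPropositional Data.Nat._≟_ using (_∈?_)
  open NormalForm
  open PowerSeries
  open GeneratingFunction
  open QuasiPolynomials

  -- 280 p, for p with denominator dividing 280.
  scaled : ℚ → ℤ
  scaled p = ↥ p ℤ.* + (280 / ↧ₙ p)

  -- Opaque, since unfolding at arguments such as 840 + t is expensive.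
  opaque
    -- 21 S₇ t - t, which depends on t modulo 21 only; the shift by 21 avoids the truncation in S₇ 0.
    σ : ℕ → ℤ
    σ t = + (21 * S₇ (21 + t)) ℤ.- + (21 + t)

  -- 280 is the least common multiple of 8, 5 and 7, where 7 comes from 72 / 21 = 24 / 7. The fixed
  -- coefficients are 35 = 280 / 8 and 1260 = 280 · 9 / 2.
  polynomialWith : ℚ → ℚ → ℚ → List ℤ
  polynomialWith x₀ x₁ x₂ = scaled x₀ ∷ - (scaled x₁ ℤ.+ + 960) ∷ scaled x₂ ∷ - + 1260 ∷ + 35 ∷ []

  opaque
    polynomialPart : ℕ → List ℤ
    polynomialPart t = polynomialWith (a₀ t) (a₁ t) (a₂ t)

  -- 280 times the constituent of t; the term 72 S₇ t is (72 / 21) (t + σ t), and 280 * 72 / 21 = 960.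
  constituentₚ : ℕ → List ℤ
  constituentₚ t = polynomialPart t +ₚ scale (- + 960) (σ t ∷ [])

  mod-cong : ∀ {m k n} .{{_ : NonZero n}} → m % n ≡ k % n → m mod n ≡ k mod n
  mod-cong eq = Fin.toℕ-injective (trans (Fin.toℕ-fromℕ< _) (trans eq (sym (Fin.toℕ-fromℕ< _))))

  [kn+m]%n≡m%n : ∀ k m n .{{_ : NonZero n}} → (k * n + m) % n ≡ m % n
  [kn+m]%n≡m%n k m n = trans (cong (_% n) (+-comm (k * n) m)) ([m+kn]%n≡m%n m k n)

  [kn+m]/n≡k+m/n : ∀ k m n .{{_ : NonZero n}} → (k * n + m) / n ≡ k + m / n
  [kn+m]/n≡k+m/n k m n = trans (+-distrib-/-∣ˡ m (divides k refl)) (cong (_+ m / n) (m*n/n≡m k n))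

  a₀-periodic : Periodic 120 a₀
  a₀-periodic t = cong₂ (λ r j → lookup (lookup a₀-table r) j)
    (mod-cong {120 + t} {t} ([kn+m]%n≡m%n 6 t 20))
    (mod-cong {(120 + t) / 20} {t / 20} (trans (cong (_% 6) ([kn+m]/n≡k+m/n 6 t 20)) ([kn+m]%n≡m%n 1 (t / 20) 6)))

  a₁-table : Vec ℚ 12
  a₁-table = (+ 1968 ∷ + 1158 ∷ + 1383 ∷ + 1653 ∷ + 1428 ∷ + 1158 ∷
              + 1923 ∷ + 1113 ∷ + 1428 ∷ + 1698 ∷ + 1383 ∷ + 1113 ∷ []) over 5

  a₁-lookup : ∀ t → a₁ t ≡ lookup a₁-table (t mod 12)
  a₁-lookup t = refl

  a₂-table : Vec ℚ 6
  a₂-table = (+ 243 ∷ + 218 ∷ + 227 ∷ + 234 ∷ + 227 ∷ + 218 ∷ []) over 4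

  a₂-lookup : ∀ t → a₂ t ≡ lookup a₂-table (t mod 6)
  a₂-lookup t = refl

  a₁-periodic : Periodic 120 a₁
  a₁-periodic t = trans (a₁-lookup (120 + t))
    (trans (cong (lookup a₁-table) (mod-cong {120 + t} {t} ([kn+m]%n≡m%n 10 t 12))) (sym (a₁-lookup t)))

  a₂-periodic : Periodic 120 a₂
  a₂-periodic t = trans (a₂-lookup (120 + t))
    (trans (cong (lookup a₂-table) (mod-cong {120 + t} {t} ([kn+m]%n≡m%n 20 t 6))) (sym (a₂-lookup t)))

  opaque
    unfolding polynomialPart

    polynomialPart-periodic : Periodic 120 polynomialPart
    polynomialPart-periodic t = polynomialWith-cong (a₀-periodic t) (a₁-periodic t) (a₂-periodic t)
      where
      polynomialWith-cong : ∀ {x x′ y y′ z z′} → x ≡ x′ → y ≡ y′ → z ≡ z′ →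
                            polynomialWith x y z ≡ polynomialWith x′ y′ z′
      polynomialWith-cong refl refl refl = refl

  -- The argument is a successor so that the truncated subtraction in `S₇` is exact.
  S₇-step : ∀ k t → S₇ (k * 21 + suc t) ≡ k + S₇ (suc t)
  S₇-step k t = trans
    (cong₂ _+_
      (trans (cong (λ m → (m ∸ 1) / 21) (+-suc (k * 21) t)) ([kn+m]/n≡k+m/n k t 21))
      (cong (λ r → if does (r ∈? (10 ∷ 13 ∷ 16 ∷ 17 ∷ 19 ∷ 20 ∷ [])) then 1 else 0) ([kn+m]%n≡m%n k (suc t) 21)))
    (+-assoc k (t / 21) (ε (suc t)))

  σ-step : ∀ s t → + (21 * suc s) ℤ.- + (21 + t) ≡ + (21 * s) ℤ.- + t
  σ-step s t = trans
    (cong₂ ℤ._-_ (trans (cong +_ (*-suc 21 s)) (ℤ.pos-+ 21 (21 * s))) (ℤ.pos-+ 21 t))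
    (solve 3 (λ x y z → (x :+ y) :- (x :+ z) := y :- z) refl (+ 21) (+ (21 * s)) (+ t))
    where open +-*-Solver

  opaque
    unfolding σ

    σ-periodic : Periodic 21 σ
    σ-periodic t = trans (cong (λ s → + (21 * s) ℤ.- + (42 + t)) (S₇-step 1 (20 + t))) (σ-step (S₇ (21 + t)) (21 + t))

    σ-S₇ : ∀ t → 1 ≤ t → σ t ≡ + (21 * S₇ t) ℤ.- + t
    σ-S₇ (suc t) _ = trans (cong (λ s → + (21 * s) ℤ.- + (21 + suc t)) (S₇-step 1 t)) (σ-step (S₇ (suc t)) (suc t))

  -- 840 = 7 · 120 = 40 · 21 is the least common multiple of the periods 120 and 21 proved for the
  -- two parts.
  constituentₚ-periodic : Periodic 840 constituentₚ
  constituentₚ-periodic t = cong₂ (λ p s → p +ₚ scale (- + 960) (s ∷ []))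
    (trans (cong polynomialPart {840 + t} {7 * 120 + t} refl) (periodic-* 120 polynomialPart polynomialPart-periodic 7 t))
    (trans (cong σ {840 + t} {40 * 21 + t} refl) (periodic-* 21 σ σ-periodic 40 t))

  constituentₚ-% : ∀ t → constituentₚ t ≡ constituentₚ (t % 840)
  constituentₚ-% t = trans (cong constituentₚ (trans (m≡m%n+[m/n]*n t 840) (+-comm (t % 840) (t / 840 * 840))))
    (periodic-* 840 constituentₚ constituentₚ-periodic (t / 840) (t % 840))

  fromCoefficients-beyond : ∀ p {n} → length p ≤ n → fromCoefficients p n ≡ + 0
  fromCoefficients-beyond []      _         = refl
  fromCoefficients-beyond (a ∷ p) (s≤s p≤n) = fromCoefficients-beyond p p≤n

  opaque
    unfolding denominatorₚ polynomialPart σ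

    polynomialPart-annihilated : Annihilates 120 polynomialPart denominatorₚ
    polynomialPart-annihilated = from-yes (allUpTo?
      (λ r → ListAll.all? (ℤ._≟ + 0) (combination polynomialPart denominatorₚ (length denominatorₚ + r))) 120)

    σ-annihilated : Annihilates 21 (λ t → σ t ∷ []) denominatorₚ
    σ-annihilated = from-yes (allUpTo?
      (λ r → ListAll.all? (ℤ._≟ + 0) (combination (λ t → σ t ∷ []) denominatorₚ (length denominatorₚ + r))) 21)

    -- In degrees up to 36 the product involves the value at index 0, which is set to 0 and not to
    -- the value 280 · 1296 of the constituent there. These degrees are therefore compared by
    -- evaluation, and they account for the whole numerator.
    constituentₚ-initial : ∀ {n} → n < 37 → (quasi constituentₚ ⋆ denominatorₚ) n ≡
      + 280 ℤ.* (+ 72 ℤ.* fromCoefficients (replicate 15 (+ 0) ++ numeratorₚ) n)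
    constituentₚ-initial = from-yes (allUpTo? (λ n → (quasi constituentₚ ⋆ denominatorₚ) n ℤ.≟
      + 280 ℤ.* (+ 72 ℤ.* fromCoefficients (replicate 15 (+ 0) ++ numeratorₚ) n)) 37)

    denominator-degree : length denominatorₚ ≡ 37
    denominator-degree = refl

  quasi-constituentₚ : ∀ n → quasi constituentₚ n ≡ quasi polynomialPart n ℤ.+ (- + 960 ∙ quasi (λ t → σ t ∷ [])) n
  quasi-constituentₚ zero      = refl
  quasi-constituentₚ n@(suc _) = trans (evaluateℤ-+ₚ (polynomialPart n) (scale (- + 960) (σ n ∷ [])) (+ n))
    (cong (λ z → evaluateℤ (polynomialPart n) (+ n) ℤ.+ z) (evaluateℤ-scale (- + 960) (σ n ∷ []) (+ n)))

  polynomialPart-vanishes : ∀ n → length denominatorₚ ≤ n → (quasi polynomialPart ⋆ denominatorₚ) n ≡ + 0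
  polynomialPart-vanishes =
    quasi-annihilated {120} polynomialPart denominatorₚ polynomialPart-periodic polynomialPart-annihilated

  σ-vanishes : ∀ n → length denominatorₚ ≤ n → (quasi (λ t → σ t ∷ []) ⋆ denominatorₚ) n ≡ + 0
  σ-vanishes =
    quasi-annihilated {21} (λ t → σ t ∷ []) denominatorₚ (λ t → cong (_∷ []) (σ-periodic t)) σ-annihilated

  quasi-constituentₚ-annihilated : ∀ n → length denominatorₚ ≤ n → (quasi constituentₚ ⋆ denominatorₚ) n ≡ + 0
  quasi-constituentₚ-annihilated n d≤n =
    trans (⋆-cong quasi-constituentₚ denominatorₚ n)
    (trans (⋆-plus (quasi polynomialPart) (- + 960 ∙ quasi (λ t → σ t ∷ [])) denominatorₚ n)
    (cong₂ ℤ._+_ (polynomialPart-vanishes n d≤n)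
      (trans (⋆-∙ (- + 960) (quasi (λ t → σ t ∷ [])) denominatorₚ n) (cong (- + 960 ℤ.*_) (σ-vanishes n d≤n)))))

  constituentₚ-beyond : ∀ {n} → 37 ≤ n → (quasi constituentₚ ⋆ denominatorₚ) n ≡
    + 280 ℤ.* (+ 72 ℤ.* fromCoefficients (replicate 15 (+ 0) ++ numeratorₚ) n)
  constituentₚ-beyond {n} 37≤n = trans (quasi-constituentₚ-annihilated n (≤-trans (≤-reflexive denominator-degree) 37≤n))
    (cong (λ z → + 280 ℤ.* (+ 72 ℤ.* z)) (sym (fromCoefficients-beyond (replicate 15 (+ 0) ++ numeratorₚ) 37≤n)))

  quasi-constituentₚ-⋆ : quasi constituentₚ ⋆ denominatorₚ ≗ + 280 ∙ (+ 72 ∙ (x^ 15 ⊛ A))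
  quasi-constituentₚ-⋆ n = trans
    ([ constituentₚ-initial , constituentₚ-beyond ]′ (<-≤-connex n 37))
    (cong (λ z → + 280 ℤ.* (+ 72 ℤ.* z)) (sym (numerator-coefficients n)))

  280Sₐ : ∀ t → 1 ≤ t → + 280 ℤ.* + Sₐ t ≡ evaluateℤ (constituentₚ t) (+ t)
  280Sₐ t@(suc _) _ = begin
    (+ 280 ∙ generatingSeries) t
      ≡⟨ by-denominator (λ n → trans (⋆-∙ (+ 280) generatingSeries denominatorₚ n)
                                  (cong (+ 280 ℤ.*_) (generatingSeries-⋆ n))) t ⟩
    ((+ 280 ∙ (+ 72 ∙ (x^ 15 ⊛ A))) ⊘ denominator) t              ≡⟨ by-denominator quasi-constituentₚ-⋆ t ⟨
    quasi constituentₚ t                                          ∎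
    where open ≡-Reasoning

-- From the integer identity to the rational formula.

module Formula where

  import Data.Fin.Properties as Fin
  open import Data.Integer as ℤ using (ℤ; +_; -_)
  import Data.Integer.Properties as ℤ
  open import Data.Integer.Solver using () renaming (module +-*-Solver to ℤ-Solver)
  open import Data.List as List using ([]; _∷_)
  open import Data.Nat as ℕ using (ℕ; suc; NonZero)
  open import Data.Nat.DivMod using (_mod_; m*n/n≡m)
  open import Data.Nat.Divisibility using (_∣_; divides; _∣?_)
  open import Data.Rational as ℚ using (ℚ; 0ℚ; 1ℚ; _/_; _+_; _*_; _-_; ↥_; ↧ₙ_; toℚᵘ; +-*-rawSemiring)
  import Data.Rational.Properties as ℚ
  open import Data.Rational.Solver using (module +-*-Solver)
  open import Data.Rational.Unnormalised as ℚᵘ using (mkℚᵘ; _≃_; *≡*)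
  import Data.Rational.Unnormalised.Properties as ℚᵘ
  open import Data.Vec using (lookup)
  open import Relation.Binary.PropositionalEquality
    using (_≡_; refl; sym; trans; cong; cong₂; module ≡-Reasoning)
  open import Relation.Nullary.Decidable using (from-yes)
  open import Algebra.Definitions.RawSemiring +-*-rawSemiring using (_^_)
  open QuasiPolynomials
  open Constituents

  fromℤ : ℤ → ℚ
  fromℤ n = n / 1

  toℚᵘ-/ : ∀ n d → toℚᵘ (n / suc d) ≃ mkℚᵘ n d
  toℚᵘ-/ n d = ℚ.toℚᵘ-fromℚᵘ (mkℚᵘ n d)

  -- `_/_` on ℚ reduces fractions by a gcd that is stuck on variables; among unnormalised rationals
  -- the claim is an integer identity.
  fromℤ-+ : ∀ m n → fromℤ (m ℤ.+ n) ≡ fromℤ m + fromℤ n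
  fromℤ-+ m n = ℚ.toℚᵘ-injective (begin
    toℚᵘ (fromℤ (m ℤ.+ n))              ≈⟨ toℚᵘ-/ (m ℤ.+ n) 0 ⟩
    mkℚᵘ (m ℤ.+ n) 0
      ≈⟨ *≡* (solve 2 (λ m n → (m :+ n) :* con (+ 1) := (m :* con (+ 1) :+ n :* con (+ 1)) :* con (+ 1)) refl m n) ⟩
    mkℚᵘ m 0 ℚᵘ.+ mkℚᵘ n 0              ≈⟨ ℚᵘ.+-cong (toℚᵘ-/ m 0) (toℚᵘ-/ n 0) ⟨
    toℚᵘ (fromℤ m) ℚᵘ.+ toℚᵘ (fromℤ n)  ≈⟨ ℚ.toℚᵘ-homo-+ (fromℤ m) (fromℤ n) ⟨
    toℚᵘ (fromℤ m + fromℤ n)            ∎)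
    where
    open ℚᵘ.≃-Reasoning
    open ℤ-Solver

  fromℤ-* : ∀ m n → fromℤ (m ℤ.* n) ≡ fromℤ m * fromℤ n
  fromℤ-* m n = ℚ.toℚᵘ-injective (begin
    toℚᵘ (fromℤ (m ℤ.* n))              ≈⟨ toℚᵘ-/ (m ℤ.* n) 0 ⟩
    mkℚᵘ m 0 ℚᵘ.* mkℚᵘ n 0              ≈⟨ ℚᵘ.*-cong (toℚᵘ-/ m 0) (toℚᵘ-/ n 0) ⟨
    toℚᵘ (fromℤ m) ℚᵘ.* toℚᵘ (fromℤ n)  ≈⟨ ℚ.toℚᵘ-homo-* (fromℤ m) (fromℤ n) ⟨
    toℚᵘ (fromℤ m * fromℤ n)            ∎)
    where open ℚᵘ.≃-Reasoning

  fromℤ-injective : ∀ {m n} → fromℤ m ≡ fromℤ n → m ≡ n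
  fromℤ-injective {m} {n} eq
    with *≡* eq′ ← ℚᵘ.≃-trans (ℚᵘ.≃-sym (toℚᵘ-/ m 0)) (ℚᵘ.≃-trans (ℚ.toℚᵘ-cong eq) (toℚᵘ-/ n 0))
    = trans (sym (ℤ.*-identityʳ m)) (trans eq′ (ℤ.*-identityʳ n))

  denominator-* : ∀ n d .{{_ : NonZero d}} → fromℤ (+ d) * (n / d) ≡ fromℤ n
  denominator-* n d@(suc d-1) = ℚ.toℚᵘ-injective (begin
    toℚᵘ (fromℤ (+ d) * (n / d))             ≈⟨ ℚ.toℚᵘ-homo-* (fromℤ (+ d)) (n / d) ⟩
    toℚᵘ (fromℤ (+ d)) ℚᵘ.* toℚᵘ (n / d)     ≈⟨ ℚᵘ.*-cong (toℚᵘ-/ (+ d) 0) (toℚᵘ-/ n d-1) ⟩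
    mkℚᵘ (+ d) 0 ℚᵘ.* mkℚᵘ n d-1
      ≈⟨ *≡* (trans (ℤ.*-identityʳ (+ d ℤ.* n)) (trans (ℤ.*-comm (+ d) n)
                (cong (λ e → n ℤ.* + e) (sym (ℕ.+-identityʳ d))))) ⟩
    mkℚᵘ n 0                                 ≈⟨ toℚᵘ-/ n 0 ⟨
    toℚᵘ (fromℤ n)                           ∎)
    where
    open ℚᵘ.≃-Reasoning
    import Data.Nat.Properties as ℕ

  scaled-correct : ∀ p → ↧ₙ p ∣ 280 → fromℤ (+ 280) * p ≡ fromℤ (scaled p)
  scaled-correct p d∣280@(divides k eq) = begin
    fromℤ (+ 280) * p                            ≡⟨ cong (λ n → fromℤ (+ n) * p) eq ⟩
    fromℤ (+ (k ℕ.* ↧ₙ p)) * p                   ≡⟨ cong (λ n → fromℤ n * p) (ℤ.pos-* k (↧ₙ p)) ⟩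
    fromℤ (+ k ℤ.* + ↧ₙ p) * p                   ≡⟨ cong (_* p) (fromℤ-* (+ k) (+ ↧ₙ p)) ⟩
    fromℤ (+ k) * fromℤ (+ ↧ₙ p) * p             ≡⟨ ℚ.*-assoc (fromℤ (+ k)) (fromℤ (+ ↧ₙ p)) p ⟩
    fromℤ (+ k) * (fromℤ (+ ↧ₙ p) * p)
      ≡⟨ cong (λ q → fromℤ (+ k) * (fromℤ (+ ↧ₙ p) * q)) (ℚ.↥p/↧p≡p p) ⟨
    fromℤ (+ k) * (fromℤ (+ ↧ₙ p) * (↥ p / ↧ₙ p)) ≡⟨ cong (fromℤ (+ k) *_) (denominator-* (↥ p) (↧ₙ p)) ⟩
    fromℤ (+ k) * fromℤ (↥ p)                    ≡⟨ ℚ.*-comm (fromℤ (+ k)) (fromℤ (↥ p)) ⟩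
    fromℤ (↥ p) * fromℤ (+ k)                    ≡⟨ fromℤ-* (↥ p) (+ k) ⟨
    fromℤ (↥ p ℤ.* + k)
      ≡⟨ cong (λ n → fromℤ (↥ p ℤ.* + n)) (trans (cong (λ n → n ℕ./ ↧ₙ p) eq) (m*n/n≡m k (↧ₙ p))) ⟨
    fromℤ (scaled p)                             ∎
    where open ≡-Reasoning

  a₀-scaled : ∀ t → fromℤ (+ 280) * a₀ t ≡ fromℤ (scaled (a₀ t))
  a₀-scaled t = scaled-correct (a₀ t) (table (t mod 20) ((t ℕ./ 20) mod 6))
    where
    table : ∀ i j → ↧ₙ (lookup (lookup a₀-table i) j) ∣ 280
    table = from-yes (Fin.all? λ i → Fin.all? λ j → ↧ₙ (lookup (lookup a₀-table i) j) ∣? 280)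

  a₁-scaled : ∀ t → fromℤ (+ 280) * a₁ t ≡ fromℤ (scaled (a₁ t))
  a₁-scaled t = scaled-correct (a₁ t) (table (t mod 12))
    where
    table : ∀ i → ↧ₙ (lookup a₁-table i) ∣ 280
    table = from-yes (Fin.all? λ i → ↧ₙ (lookup a₁-table i) ∣? 280)

  a₂-scaled : ∀ t → fromℤ (+ 280) * a₂ t ≡ fromℤ (scaled (a₂ t))
  a₂-scaled t = scaled-correct (a₂ t) (table (t mod 6))
    where
    table : ∀ i → ↧ₙ (lookup a₂-table i) ∣ 280
    table = from-yes (Fin.all? λ i → ↧ₙ (lookup a₂-table i) ∣? 280)

  evaluate-fromℤ : ∀ p x → evaluate (List.map fromℤ p) (fromℤ x) ≡ fromℤ (evaluateℤ p x)
  evaluate-fromℤ []      x = refl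
  evaluate-fromℤ (a ∷ p) x = trans (cong (λ z → fromℤ a + fromℤ x * z) (evaluate-fromℤ p x))
    (trans (cong (λ z → fromℤ a + z) (sym (fromℤ-* x (evaluateℤ p x)))) (sym (fromℤ-+ a (x ℤ.* evaluateℤ p x))))

  cancel-280 : ∀ {p q} → fromℤ (+ 280) * p ≡ fromℤ (+ 280) * q → p ≡ q
  cancel-280 {p} {q} eq = begin
    -- `(+ 1 / 280) * fromℤ (+ 280)` evaluates to `1ℚ`, so the identity law applies as it stands.
    p                                  ≡⟨ ℚ.*-identityˡ p ⟨
    (+ 1 / 280) * fromℤ (+ 280) * p    ≡⟨ ℚ.*-assoc (+ 1 / 280) (fromℤ (+ 280)) p ⟩
    (+ 1 / 280) * (fromℤ (+ 280) * p)  ≡⟨ cong ((+ 1 / 280) *_) eq ⟩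
    (+ 1 / 280) * (fromℤ (+ 280) * q)  ≡⟨ ℚ.*-assoc (+ 1 / 280) (fromℤ (+ 280)) q ⟨
    (+ 1 / 280) * fromℤ (+ 280) * q    ≡⟨ ℚ.*-identityˡ q ⟩
    q                                  ∎
    where open ≡-Reasoning

  280Sₐ-ℚ : ∀ t → 1 ℕ.≤ t → fromℤ (+ 280) * fromℕ (Sₐ t) ≡ fromℤ (evaluateℤ (constituentₚ t) (+ t))
  280Sₐ-ℚ t 1≤t = trans (sym (fromℤ-* (+ 280) (+ Sₐ t))) (cong fromℤ (280Sₐ t 1≤t))

  fromℤ-neg : ∀ n → fromℤ (- n) ≡ ℚ.- fromℤ n
  fromℤ-neg n = trans (cong fromℤ (sym (ℤ.-1*i≡-i n)))
    (trans (fromℤ-* (- + 1) n) (solve 1 (λ x → con (fromℤ (- + 1)) :* x := :- x) refl (fromℤ n)))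
    where open +-*-Solver

  formula : (T x₀ x₁ x₂ s : ℚ) → ℚ
  formula T x₀ x₁ x₂ s =
    (+ 1 / 8) * T ^ 4 - (+ 9 / 2) * T ^ 3 + x₂ * T ^ 2 - x₁ * T + x₀ - fromℕ 72 * s

  scaledFormula : (z₀ z₁ z₂ z : ℚ) → Polynomial
  scaledFormula z₀ z₁ z₂ z =
    (z₀ + fromℤ (- + 960) * z) ∷ ℚ.- (z₁ + fromℤ (+ 960)) ∷ z₂ ∷ fromℤ (- + 1260) ∷ fromℤ (+ 35) ∷ []

  formula-scaled : ∀ {T x₀ x₁ x₂ s z₀ z₁ z₂ z} →
    fromℤ (+ 280) * x₀ ≡ z₀ → fromℤ (+ 280) * x₁ ≡ z₁ → fromℤ (+ 280) * x₂ ≡ z₂ → fromℤ (+ 21) * s - T ≡ z →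
    fromℤ (+ 280) * formula T x₀ x₁ x₂ s ≡
    evaluate (scaledFormula z₀ z₁ z₂ z) T
  formula-scaled {T} {x₀} {x₁} {x₂} {s} refl refl refl refl =
    solve 5 (λ T x₀ x₁ x₂ s →
      con (fromℤ (+ 280)) :*
        -- The powers are spelled out as the nested products, ending in `1ℚ`, to which `_^_`
        -- unfolds.
        (con (+ 1 / 8) :* (T :* (T :* (T :* (T :* con 1ℚ)))) :- con (+ 9 / 2) :* (T :* (T :* (T :* con 1ℚ)))
         :+ x₂ :* (T :* (T :* con 1ℚ)) :- x₁ :* T :+ x₀ :- con (fromℕ 72) :* s)
      := (con (fromℤ (+ 280)) :* x₀ :+ con (fromℤ (- + 960)) :* (con (fromℤ (+ 21)) :* s :- T)) :+ T :*
        (:- (con (fromℤ (+ 280)) :* x₁ :+ con (fromℤ (+ 960))) :+ T :*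
        (con (fromℤ (+ 280)) :* x₂ :+ T :*
        (con (fromℤ (- + 1260)) :+ T :*
        (con (fromℤ (+ 35)) :+ T :* con 0ℚ)))))
      refl T x₀ x₁ x₂ s
    where open +-*-Solver

  opaque
    unfolding polynomialPart

    map-constituentₚ : ∀ t → List.map fromℤ (constituentₚ t) ≡
      scaledFormula (fromℤ (scaled (a₀ t))) (fromℤ (scaled (a₁ t))) (fromℤ (scaled (a₂ t))) (fromℤ (σ t))
    map-constituentₚ t = cong₂ (λ x y → x ∷ y ∷ fromℤ (scaled (a₂ t)) ∷ fromℤ (- + 1260) ∷ fromℤ (+ 35) ∷ [])
      (trans (fromℤ-+ (scaled (a₀ t)) (- + 960 ℤ.* σ t)) (cong (λ z → fromℤ (scaled (a₀ t)) + z) (fromℤ-* (- + 960) (σ t))))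
      (trans (fromℤ-neg (scaled (a₁ t) ℤ.+ + 960)) (cong ℚ.-_ (fromℤ-+ (scaled (a₁ t)) (+ 960))))

  fromℤ-σ : ∀ t → 1 ℕ.≤ t → fromℤ (+ 21) * fromℕ (S₇ t) - fromℕ t ≡ fromℤ (σ t)
  fromℤ-σ t 1≤t = sym (begin
    fromℤ (σ t)                                            ≡⟨ cong fromℤ (σ-S₇ t 1≤t) ⟩
    fromℤ (+ (21 ℕ.* S₇ t) ℤ.- + t)                        ≡⟨ fromℤ-+ (+ (21 ℕ.* S₇ t)) (- + t) ⟩
    fromℤ (+ (21 ℕ.* S₇ t)) + fromℤ (- + t)
      ≡⟨ cong₂ _+_ (trans (cong fromℤ (ℤ.pos-* 21 (S₇ t))) (fromℤ-* (+ 21) (+ S₇ t))) (fromℤ-neg (+ t)) ⟩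
    fromℤ (+ 21) * fromℕ (S₇ t) - fromℕ t                  ∎)
    where open ≡-Reasoning

  Sₐ-formula : ∀ t → 1 ℕ.≤ t → fromℕ (Sₐ t) ≡ formula (fromℕ t) (a₀ t) (a₁ t) (a₂ t) (fromℕ (S₇ t))
  Sₐ-formula t 1≤t = cancel-280 (begin
    fromℤ (+ 280) * fromℕ (Sₐ t)                                                   ≡⟨ 280Sₐ-ℚ t 1≤t ⟩
    fromℤ (evaluateℤ (constituentₚ t) (+ t))
      ≡⟨ evaluate-fromℤ (constituentₚ t) (+ t) ⟨
    evaluate (List.map fromℤ (constituentₚ t)) (fromℕ t)
      ≡⟨ cong (λ p → evaluate p (fromℕ t)) (map-constituentₚ t) ⟩
    evaluate (scaledFormula (fromℤ (scaled (a₀ t))) (fromℤ (scaled (a₁ t))) (fromℤ (scaled (a₂ t))) (fromℤ (σ t))) (fromℕ t)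
      ≡⟨ formula-scaled {fromℕ t} {a₀ t} {a₁ t} {a₂ t} {fromℕ (S₇ t)}
           (a₀-scaled t) (a₁-scaled t) (a₂-scaled t) (fromℤ-σ t 1≤t) ⟨
    fromℤ (+ 280) * formula (fromℕ t) (a₀ t) (a₁ t) (a₂ t) (fromℕ (S₇ t))          ∎)
    where open ≡-Reasoning

-- Uniqueness of constituents and minimality of the period.

module Period where

  open import Data.Fin as Fin using (Fin; toℕ)
  import Data.Fin.Properties as Fin
  open import Data.Integer as ℤ using (ℤ; +_; -_)
  import Data.Integer.Properties as ℤ
  open import Data.List as List using (List; []; _∷_; length)
  open import Data.Nat as ℕ using (ℕ; zero; suc; NonZero; z≤n; s≤s)
  open import Data.Nat.DivMod using (_mod_; n%n≡0; m*n%n≡0; [m+kn]%n≡m%n)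
  import Data.Nat.Properties as ℕ
  open import Data.Product using (_,_)
  open import Data.Rational as ℚ using (ℚ; 0ℚ; 1ℚ; _/_; _+_; _*_; _-_)
  import Data.Rational.Properties as ℚ
  open import Data.Rational.Solver using (module +-*-Solver)
  open import Function using (_∘_)
  open import Function.Definitions using (Injective)
  open import Relation.Binary.PropositionalEquality
    using (_≡_; _≢_; refl; sym; trans; cong; cong₂; module ≡-Reasoning)
  open import Relation.Nullary.Decidable using (from-yes; ¬?; _→-dec_)
  open QuasiPolynomials
  open Constituents
  open Formula

  constituent : Fin 840 → Polynomial
  constituent r = List.map (_/ 280) (constituentₚ (toℕ r))

  evaluate-/280 : ∀ p x → fromℤ (+ 280) * evaluate (List.map (_/ 280) p) x ≡ evaluate (List.map fromℤ p) x
  evaluate-/280 []      x = refl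
  evaluate-/280 (a ∷ p) x = trans
    (solve 4 (λ k a x y → k :* (a :+ x :* y) := k :* a :+ x :* (k :* y)) refl
      (fromℤ (+ 280)) (a / 280) x (evaluate (List.map (_/ 280) p) x))
    (cong₂ (λ y z → y + x * z) (denominator-* a 280) (evaluate-/280 p x))
    where open +-*-Solver

  constituentₚ-mod : ∀ t → constituentₚ t ≡ constituentₚ (toℕ (t mod 840))
  constituentₚ-mod t = trans (constituentₚ-% t) (cong constituentₚ (sym (Fin.toℕ-fromℕ< _)))

  Sₐ-constituents : HasConstituents (fromℕ ∘ Sₐ) 840 constituent
  Sₐ-constituents t 1≤t = cancel-280 (begin
    fromℤ (+ 280) * fromℕ (Sₐ t)                                           ≡⟨ 280Sₐ-ℚ t 1≤t ⟩
    fromℤ (evaluateℤ (constituentₚ t) (+ t))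
      ≡⟨ evaluate-fromℤ (constituentₚ t) (+ t) ⟨
    evaluate (List.map fromℤ (constituentₚ t)) (fromℕ t)
      ≡⟨ cong (λ p → evaluate (List.map fromℤ p) (fromℕ t)) (constituentₚ-mod t) ⟩
    evaluate (List.map fromℤ (constituentₚ (toℕ (t mod 840)))) (fromℕ t)
      ≡⟨ evaluate-/280 (constituentₚ (toℕ (t mod 840))) (fromℕ t) ⟨
    fromℤ (+ 280) * evaluate (constituent (t mod 840)) (fromℕ t)           ∎)
    where open ≡-Reasoning

  -- Synthetic division of p by x - r, without the remainder evaluate p r.
  deflate : ℚ → Polynomial → Polynomial
  deflate r []               = []
  deflate r (_ ∷ [])         = []
  deflate r (_ ∷ as@(_ ∷ _)) = evaluate as r ∷ deflate r as

  evaluate-deflate : ∀ r p x → evaluate p x ≡ evaluate p r + (x - r) * evaluate (deflate r p) x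
  evaluate-deflate r []               x = solve 2 (λ x r → con 0ℚ := con 0ℚ :+ (x :- r) :* con 0ℚ) refl x r
    where open +-*-Solver
  evaluate-deflate r (a ∷ [])         x =
    solve 3 (λ a x r → a :+ x :* con 0ℚ := (a :+ r :* con 0ℚ) :+ (x :- r) :* con 0ℚ) refl a x r
    where open +-*-Solver
  evaluate-deflate r (a ∷ as@(_ ∷ _)) x = trans (cong (λ z → a + x * z) (evaluate-deflate r as x))
    (solve 5 (λ a x r y z → a :+ x :* (y :+ (x :- r) :* z) := (a :+ r :* y) :+ (x :- r) :* (y :+ x :* z)) refl
      a x r (evaluate as r) (evaluate (deflate r as) x))
    where open +-*-Solver

  length-deflate : ∀ r p n → length p ℕ.≤ suc n → length (deflate r p) ℕ.≤ n
  length-deflate r []               n       _         = z≤n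
  length-deflate r (_ ∷ [])         n       _         = z≤n
  length-deflate r (_ ∷ as@(_ ∷ _)) (suc n) (s≤s le)  = s≤s (length-deflate r as n le)

  cancel-nonZero : ∀ {p q} → p ≢ 0ℚ → p * q ≡ 0ℚ → q ≡ 0ℚ
  cancel-nonZero {p} {q} p≢0 eq = begin
    q                  ≡⟨ ℚ.*-identityˡ q ⟨
    1ℚ * q             ≡⟨ cong (_* q) (ℚ.*-inverseˡ p) ⟨
    ℚ.1/ p * p * q     ≡⟨ ℚ.*-assoc (ℚ.1/ p) p q ⟩
    ℚ.1/ p * (p * q)   ≡⟨ cong (ℚ.1/ p *_) eq ⟩
    ℚ.1/ p * 0ℚ        ≡⟨ ℚ.*-zeroʳ (ℚ.1/ p) ⟩
    0ℚ                 ∎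
    where
    open ≡-Reasoning
    instance _ = ℚ.≢-nonZero p≢0

  difference≢0 : ∀ {x y} → x ≢ y → x - y ≢ 0ℚ
  difference≢0 {x} {y} x≢y eq = x≢y (begin
    x             ≡⟨ solve 2 (λ x y → x := (x :- y) :+ y) refl x y ⟩
    x - y + y     ≡⟨ cong (_+ y) eq ⟩
    0ℚ + y        ≡⟨ ℚ.+-identityˡ y ⟩
    y             ∎)
    where
    open ≡-Reasoning
    open +-*-Solver

  -- Each zero splits off a linear factor, and by injectivity the remaining points are zeros of the
  -- quotient, which has a shorter list. The conclusion concerns values because a list may end in
  -- zero coefficients.
  infinitely-many-zeros : ∀ n p → length p ℕ.≤ n → (x : ℕ → ℚ) → Injective _≡_ _≡_ x →
                          (∀ s → evaluate p (x s) ≡ 0ℚ) → ∀ y → evaluate p y ≡ 0ℚ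
  infinitely-many-zeros zero    []  _  x inj zeros y = refl
  infinitely-many-zeros (suc n) p le x inj zeros y = begin
    evaluate p y                               ≡⟨ evaluate-deflate r p y ⟩
    evaluate p r + (y - r) * evaluate q y      ≡⟨ cong₂ (λ a b → a + (y - r) * b) (zeros 0) q-zero ⟩
    0ℚ + (y - r) * 0ℚ                          ≡⟨ trans (ℚ.+-identityˡ _) (ℚ.*-zeroʳ (y - r)) ⟩
    0ℚ                                         ∎
    where
    open ≡-Reasoning
    r = x 0
    q = deflate r p

    q-zeros : ∀ s → evaluate q (x (suc s)) ≡ 0ℚ
    q-zeros s = cancel-nonZero (difference≢0 (λ eq → ℕ.1+n≢0 (inj eq))) (begin
      (x (suc s) - r) * evaluate q (x (suc s))                   ≡⟨ ℚ.+-identityˡ _ ⟨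
      0ℚ + (x (suc s) - r) * evaluate q (x (suc s))
        ≡⟨ cong (_+ (x (suc s) - r) * evaluate q (x (suc s))) (zeros 0) ⟨
      evaluate p r + (x (suc s) - r) * evaluate q (x (suc s))    ≡⟨ evaluate-deflate r p (x (suc s)) ⟨
      evaluate p (x (suc s))                                     ≡⟨ zeros (suc s) ⟩
      0ℚ                                                         ∎)

    q-zero : evaluate q y ≡ 0ℚ
    q-zero = infinitely-many-zeros n q (length-deflate r p n le) (x ∘ suc) (ℕ.suc-injective ∘ inj) q-zeros y

  subtract : Polynomial → Polynomial → Polynomial
  subtract p        []       = p
  subtract []       (b ∷ q)  = ℚ.- b ∷ subtract [] q
  subtract (a ∷ p)  (b ∷ q)  = a - b ∷ subtract p q

  evaluate-subtract : ∀ p q x → evaluate (subtract p q) x ≡ evaluate p x - evaluate q x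
  evaluate-subtract p       []      x = sym (ℚ.+-identityʳ _)
  evaluate-subtract []      (b ∷ q) x = trans (cong (λ z → ℚ.- b + x * z) (evaluate-subtract [] q x))
    (solve 3 (λ b x z → :- b :+ x :* (con 0ℚ :- z) := con 0ℚ :- (b :+ x :* z)) refl b x (evaluate q x))
    where open +-*-Solver
  evaluate-subtract (a ∷ p) (b ∷ q) x = trans (cong (λ z → a - b + x * z) (evaluate-subtract p q x))
    (solve 5 (λ a b x y z → a :- b :+ x :* (y :- z) := (a :+ x :* y) :- (b :+ x :* z)) refl a b x (evaluate p x) (evaluate q x))
    where open +-*-Solver

  agree-everywhere : ∀ p q (x : ℕ → ℚ) → Injective _≡_ _≡_ x →
                     (∀ s → evaluate p (x s) ≡ evaluate q (x s)) → ∀ y → evaluate p y ≡ evaluate q y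
  agree-everywhere p q x inj agree y = begin
    evaluate p y
      ≡⟨ solve 2 (λ a b → a := (a :- b) :+ b) refl (evaluate p y) (evaluate q y) ⟩
    evaluate p y - evaluate q y + evaluate q y
      ≡⟨ cong (_+ evaluate q y) (trans (sym (evaluate-subtract p q y)) zero-at-y) ⟩
    0ℚ + evaluate q y                               ≡⟨ ℚ.+-identityˡ _ ⟩
    evaluate q y                                    ∎
    where
    open ≡-Reasoning
    open +-*-Solver
    zero-at-y : evaluate (subtract p q) y ≡ 0ℚ
    zero-at-y = infinitely-many-zeros _ (subtract p q) ℕ.≤-refl x inj
      (λ s → trans (evaluate-subtract p q (x s))
        (trans (cong (_- evaluate q (x s)) (agree s)) (ℚ.+-inverseʳ (evaluate q (x s))))) y

  -- At every positive t congruent to r modulo both p and q the two constituents compute the same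
  -- `N t`; shifting r by multiples of pq yields infinitely many such t.
  same-constituents : ∀ {N p q} .{{_ : NonZero p}} .{{_ : NonZero q}} {c d} →
                      HasConstituents N p c → HasConstituents N q d →
                      ∀ r y → evaluate (c (r mod p)) y ≡ evaluate (d (r mod q)) y
  same-constituents {N} {p} {q} {c} {d} hc hd r = agree-everywhere (c (r mod p)) (d (r mod q)) (fromℕ ∘ point) inj agree
    where
    point : ℕ → ℕ
    -- The factor `suc s` keeps the points positive even for r = 0, as constituents describe N only
    -- from 1 on.
    point s = r ℕ.+ suc s ℕ.* (p ℕ.* q)

    instance
      pq≢0 : NonZero (p ℕ.* q)
      pq≢0 = ℕ.m*n≢0 p q

    inj : Injective _≡_ _≡_ (fromℕ ∘ point)
    inj eq = ℕ.suc-injective (ℕ.*-cancelʳ-≡ _ _ (p ℕ.* q) (ℕ.+-cancelˡ-≡ r _ _ (ℤ.+-injective (fromℤ-injective eq))))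

    point-positive : ∀ s → 1 ℕ.≤ point s
    point-positive s = ℕ.≤-trans (ℕ.>-nonZero⁻¹ (p ℕ.* q)) (ℕ.≤-trans (ℕ.m≤m+n (p ℕ.* q) _) (ℕ.m≤n+m _ r))

    point-mod-p : ∀ s → point s mod p ≡ r mod p
    point-mod-p s = mod-cong (trans
      (cong (λ m → (r ℕ.+ m) ℕ.% p) (trans (cong (suc s ℕ.*_) (ℕ.*-comm p q)) (sym (ℕ.*-assoc (suc s) q p))))
      ([m+kn]%n≡m%n r (suc s ℕ.* q) p))

    point-mod-q : ∀ s → point s mod q ≡ r mod q
    point-mod-q s = mod-cong (trans
      (cong (λ m → (r ℕ.+ m) ℕ.% q) (sym (ℕ.*-assoc (suc s) p q)))
      ([m+kn]%n≡m%n r (suc s ℕ.* p) q))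

    agree : ∀ s → evaluate (c (r mod p)) (fromℕ (point s)) ≡ evaluate (d (r mod q)) (fromℕ (point s))
    agree s = begin
      evaluate (c (r mod p)) (fromℕ (point s))
        ≡⟨ cong (λ i → evaluate (c i) (fromℕ (point s))) (point-mod-p s) ⟨
      evaluate (c (point s mod p)) (fromℕ (point s))  ≡⟨ hc (point s) (point-positive s) ⟨
      N (point s)                                     ≡⟨ hd (point s) (point-positive s) ⟩
      evaluate (d (point s mod q)) (fromℕ (point s))
        ≡⟨ cong (λ i → evaluate (d i) (fromℕ (point s))) (point-mod-q s) ⟩
      evaluate (d (r mod q)) (fromℕ (point s))        ∎
      where open ≡-Reasoning

  constantTerm : List ℤ → ℤ
  constantTerm p = evaluateℤ p (+ 0)

  opaque
    unfolding polynomialPart σ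

    -- The class of 0 shares its constant term with no other class modulo 840. Hence one comparison
    -- refutes every smaller quasiperiod, whether or not it divides 840.
    constantTerm-0 : ∀ {q} → q ℕ.< 840 → 1 ℕ.≤ q → constantTerm (constituentₚ q) ≢ constantTerm (constituentₚ 0)
    constantTerm-0 = from-yes (ℕ.allUpTo? (λ q → (1 ℕ.≤? q) →-dec
      ¬? (constantTerm (constituentₚ q) ℤ.≟ constantTerm (constituentₚ 0))) 840)

    -- Here `σ 0` is -21, so the `S₇` term contributes 72 to the constant 1224 and 24 / 7 to the
    -- linear coefficient 1968 / 5, giving 1296 and 13896 / 35.
    constituent-0 : constituent (0 mod 840) ≡ + 1296 / 1 ∷ ℚ.- (+ 13896 / 35) ∷ + 243 / 4 ∷ ℚ.- (+ 9 / 2) ∷ + 1 / 8 ∷ []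
    constituent-0 = refl

  constantTerm-mod : ∀ r s → evaluate (constituent (r mod 840)) 0ℚ ≡ evaluate (constituent (s mod 840)) 0ℚ →
                     constantTerm (constituentₚ r) ≡ constantTerm (constituentₚ s)
  constantTerm-mod r s eq = fromℤ-injective (trans (sym (value r)) (trans (cong (fromℤ (+ 280) *_) eq) (value s)))
    where
    value : ∀ r → fromℤ (+ 280) * evaluate (constituent (r mod 840)) 0ℚ ≡ fromℤ (constantTerm (constituentₚ r))
    value r = trans (evaluate-/280 (constituentₚ (toℕ (r mod 840))) 0ℚ)
      (trans (evaluate-fromℤ (constituentₚ (toℕ (r mod 840))) (+ 0))
        (cong (fromℤ ∘ constantTerm) (sym (constituentₚ-mod r))))

  Sₐ-period : HasPeriod (fromℕ ∘ Sₐ) 840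
  Sₐ-period = (constituent , Sₐ-constituents) , minimal
    where
    minimal : ∀ q .{{_ : NonZero q}} → IsQuasiperiod (fromℕ ∘ Sₐ) q → 840 ℕ.≤ q
    minimal q (d , hd) = ℕ.≮⇒≥ λ q<840 → constantTerm-0 q<840 (ℕ.>-nonZero⁻¹ q) (constantTerm-mod q 0 (begin
      evaluate (constituent (q mod 840)) 0ℚ  ≡⟨ same q ⟩
      evaluate (d (q mod q)) 0ℚ              ≡⟨ cong (λ i → evaluate (d i) 0ℚ) (mod-cong {q} {0} (q%q≡0%q q)) ⟩
      evaluate (d (0 mod q)) 0ℚ              ≡⟨ same 0 ⟨
      evaluate (constituent (0 mod 840)) 0ℚ  ∎))
      where
      open ≡-Reasoning
      same : ∀ r → evaluate (constituent (r mod 840)) 0ℚ ≡ evaluate (d (r mod q)) 0ℚ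
      same r = same-constituents {fromℕ ∘ Sₐ} {840} {q} {constituent} {d} Sₐ-constituents hd r 0ℚ

      q%q≡0%q : ∀ q .{{_ : NonZero q}} → q ℕ.% q ≡ 0 ℕ.% q
      q%q≡0%q q = trans (n%n≡0 q) (sym (m*n%n≡0 0 q))

open import Data.Integer using (+_)
open import Data.List using ([]; _∷_)
open import Data.Nat using (ℕ; _≤_)
open import Data.Product using (_×_; _,_)
open import Data.Rational.Base using (_/_; _+_; _*_; _-_; -_; +-*-rawSemiring)
open import Algebra.Definitions.RawSemiring +-*-rawSemiring using (_^_)
open import Function using (_∘_)
open import Relation.Binary.PropositionalEquality using (_≡_; _≗_)
open GeneratingFunction using (generatingSeries-quotient)
open Formula using (Sₐ-formula)
open Period using (constituent; constituent-0; Sₐ-constituents; Sₐ-period)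

mainTheorem4 : (generatingSeries ≗ (+ 72 ∙ (x^ 15 ⊛ A)) ⊘ denominator)
    × (∀ (t : ℕ) → 1 ≤ t →
    fromℕ (Sₐ t) ≡
    (+ 1 / 8) * fromℕ t ^ 4 - (+ 9 / 2) * fromℕ t ^ 3
    + a₂ t * fromℕ t ^ 2 - a₁ t * fromℕ t + a₀ t
    - fromℕ 72 * fromℕ (S₇ t))
    × HasPeriod (fromℕ ∘ Sₐ) 840
    × IsPrincipalConstituent (fromℕ ∘ Sₐ)
    (+ 1296 / 1 ∷ - (+ 13896 / 35) ∷ + 243 / 4 ∷ - (+ 9 / 2) ∷ + 1 / 8 ∷ [])
mainTheorem4 =
  generatingSeries-quotient , Sₐ-formula , Sₐ-period ,
  (840 , _ , Sₐ-period , constituent , Sₐ-constituents , constituent-0)
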